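{- Let $G$ be a finite simple graph with at least one edge and no isolated vertices, and let $A(G)$ be its anchor hypergraph. Then $$\beta(A(G))=\tfrac13\iff\chi_f(G)\le3,\qquad\text{and}\qquad \mathrm{NCF}(e_{A(G)})=1\iff\chi_f(G)\le3 .$$
   Context: $\chi_f(G)$ is the fractional chromatic number: the minimum of $\sum_I\lambda_I$ over nonnegative weights $\lambda_I$ on independent sets $I$ of $G$ with $\sum_{I\ni v}\lambda_I\ge1$ for every vertex $v$. Anchor hypergraph: choose an orientation of every edge of $G=(V,E)$. $A(G)$ is the ordered $3$-uniform hypergraph with vertex set $V\cup\{r\}$ ($r\notin V$) and one ordered hyperedge $(r,u,v)$ for each oriented edge $u\to v$ of $G$. It is always properly two-colourable. For an ordered $3$-uniform hypergraph $H$ (hyperedges are ordered triples of distinct vertices), a proper two-colouring is a $\{0,1\}$-colouring of the vertices nonconstant on every hyperedge; it is identified with its global complement, and $\mathcal C(H)$ is the set of complement classes. For a hyperedge $e=(v_1,v_2,v_3)$ and $S\in\mathcal C(H)$, $m_e(S)$ is the minority position: the index $j$ such that the colour of $v_j$ differs from the common colour of the other two. When $\mathcal C(H)\neq\varnothing$ and $H$ has a hyperedge, $\beta(H):=\min_q\max_{e,\,j\in\{1,2,3\}}\Pr_{S\sim q}[m_e(S)=j]$, with $q$ ranging over probability distributions on $\mathcal C(H)$. $\mathrm{NAE}_3=\{0,1\}^3\setminus\{000,111\}$. The uniform $\mathrm{NAE}_3$ empirical model $e_H$: observables (outcomes in $\{0,1\}$) are one central observable for each non-isolated vertex, and for each hyperedge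 $e=(v_1,v_2,v_3)$ and $j$ a fresh observable $v_j^e$. Contexts and tables: for each $e$, the context $(v_1^e,v_2^e,v_3^e)$ with the uniform distribution on $\mathrm{NAE}_3$ (mass $1/6$ on each of the six tuples, $0$ otherwise); for each $e,j$, the context $(v_j,v_j^e)$ with mass $1/2$ on $(0,0)$ and on $(1,1)$ and $0$ otherwise. For a finite empirical model $e$ with tables $e_C$, $\mathrm{NCF}(e)=\max\{\sum_g b_g:\ \sum_{g:\,g|_C=u}b_g\le e_C(u)\text{ for all contexts }C\text{ and local outcomes }u,\ b_g\ge0\}$, where $g$ ranges over all global assignments of outcomes to observables.
   Formalization: The weights on independent sets, the probability distributions on colouring classes, the weights on global assignments, and hence the optima χ_f, β and NCF, are taken over the rationals instead of the reals (all are linear programs with rational data). -}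

module Defs where

open import Data.Bool.Base using (Bool; true; false; not; if_then_else_)
import Data.Bool.Properties as Bool
open import Data.Fin.Base using (Fin; zero; suc)
import Data.Fin.Properties as Fin
open import Data.Fin.Subset using (Subset; _∈_)
open import Data.Fin.Subset.Properties using (_∈?_)
open import Data.Integer.Base using (+_)
open import Data.List.Base
  using (List; []; _∷_; _++_; map; concatMap; filter; foldr; allFin;
         cartesianProduct; deduplicate)
import Data.List.Membership.Propositional as List
open import Data.List.Relation.Unary.All using (All; all?)
import Data.List.Relation.Unary.All as All
import Data.List.Relation.Unary.All.Properties as All
open import Data.List.Relation.Unary.Any using (Any; any?)
open import Data.List.Relation.Unary.Unique.Propositional using (Unique)
import Data.List.Relation.Unary.Unique.Propositional.Properties as Unique
import Data.List.Membership.Propositional.Properties as List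
open import Data.Nat.Base using (ℕ; zero; suc)
open import Data.Product.Base using (∃-syntax; _×_; _,_; uncurry)
open import Data.Product.Properties using () renaming (≡-dec to ×-≡-dec)
open import Data.Rational.Base using (ℚ; 0ℚ; 1ℚ; ½; _+_; _≤_; _/_)
open import Data.Sum.Base using (_⊎_; inj₁; inj₂)
open import Data.Sum.Properties using (inj₁-injective; inj₂-injective)
  renaming (≡-dec to ⊎-≡-dec)
open import Data.Vec.Base as Vec using (Vec; []; _∷_; lookup)
import Data.Vec.Membership.Propositional as Vec
import Data.Vec.Membership.Propositional.Properties as Vec
import Data.Vec.Membership.DecPropositional as DecVec
import Data.Vec.Properties as Vec
import Data.Vec.Relation.Unary.All as VecAll
import Data.Vec.Relation.Unary.AllPairs as VecPairs
import Data.Vec.Relation.Unary.Unique.Propositional as Vec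
open import Function.Base using (_∘_; case_of_)
open import Level using (0ℓ)
open import Relation.Binary using (Rel; Decidable; DecidableEquality; Symmetric; Irreflexive)
open import Relation.Binary.PropositionalEquality using (_≡_; _≢_; refl)
open import Relation.Nullary using (¬_; ¬?; does)
open import Relation.Nullary.Decidable using (_→-dec_; _⊎-dec_)
open import Relation.Unary using (Pred)
import Relation.Unary as Unary

-- Weights and probabilities are rational: the optima in question are those of
-- linear programs with rational data, which rational points attain.
IsMinimum IsMaximum : Pred ℚ 0ℓ → Pred ℚ 0ℓ
IsMinimum P x = P x × (∀ y → P y → x ≤ y)
IsMaximum P x = P x × (∀ y → P y → y ≤ x)

∑ : {A : Set} → List A → (A → ℚ) → ℚ
∑ xs f = foldr _+_ 0ℚ (map f xs)

boolVecs : ∀ n → List (Vec Bool n)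
boolVecs zero    = [] ∷ []
boolVecs (suc n) = map (false ∷_) (boolVecs n) ++ map (true ∷_) (boolVecs n)

record SimpleGraph (n : ℕ) : Set₁ where
  field
    Adj    : Rel (Fin n) 0ℓ
    adj?   : Decidable Adj
    sym    : Symmetric Adj
    irrefl : Irreflexive _≡_ Adj

module _ {n : ℕ} (G : SimpleGraph n) where
  open SimpleGraph G

  HasEdge : Set
  HasEdge = ∃[ u ] ∃[ v ] Adj u v

  NoIsolatedVertices : Set
  NoIsolatedVertices = ∀ u → ∃[ v ] Adj u v

  Independent : Pred (Subset n) 0ℓ
  Independent I = ∀ u v → u ∈ I → v ∈ I → ¬ Adj u v

  independent? : Unary.Decidable Independent
  independent? I = Fin.all? λ u → Fin.all? λ v →
    (u ∈? I) →-dec ((v ∈? I) →-dec ¬? (adj? u v))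

  independentSets : List (Subset n)
  independentSets = filter independent? (boolVecs n)

  -- Only the values of w on independent sets enter the sums.
  IsFractionalColouring : Pred (Subset n → ℚ) 0ℓ
  IsFractionalColouring w =
    (∀ I → 0ℚ ≤ w I) ×
    (∀ v → 1ℚ ≤ ∑ (filter (v ∈?_) independentSets) w)

  IsFractionalChromaticNumber : Pred ℚ 0ℓ
  IsFractionalChromaticNumber = IsMinimum λ x →
    ∃[ w ] IsFractionalColouring w × x ≡ ∑ independentSets w

  record Orientation : Set₁ where
    field
      _⟶_    : Rel (Fin n) 0ℓ
      _⟶?_   : Decidable _⟶_
      sound  : ∀ {u v} → u ⟶ v → Adj u v
      covers : ∀ {u v} → Adj u v → u ⟶ v ⊎ v ⟶ u
      asym   : ∀ {u v} → u ⟶ v → ¬ v ⟶ u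

Triple : ℕ → Set
Triple m = Vec (Fin m) 3

record Hypergraph₃ (m : ℕ) : Set where
  field
    hyperedges : List (Triple m)
    unique     : Unique hyperedges
    uniform    : All Vec.Unique hyperedges

module _ {n : ℕ} {G : SimpleGraph n} (O : Orientation G) where
  open SimpleGraph G
  open Orientation O

  arcs : List (Fin n × Fin n)
  arcs = filter (λ (u , v) → u ⟶? v) (cartesianProduct (allFin n) (allFin n))

  -- The anchor r is vertex zero; the vertex v of G becomes suc v.
  anchorEdge : Fin n × Fin n → Triple (suc n)
  anchorEdge (u , v) = zero ∷ suc u ∷ suc v ∷ []

  anchor : Hypergraph₃ (suc n)
  anchor = record
    { hyperedges = map anchorEdge arcs
    ; unique     = Unique.map⁺ (λ { refl → refl })
        (Unique.filter⁺ (λ (u , v) → u ⟶? v)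
          (Unique.cartesianProduct⁺ (Unique.allFin⁺ n) (Unique.allFin⁺ n)))
    ; uniform    = All.map⁺ (All.map distinct
        (All.all-filter (λ (u , v) → u ⟶? v) (cartesianProduct (allFin n) (allFin n))))
    }
    where
    distinct : ∀ {a} → uncurry _⟶_ a → Vec.Unique (anchorEdge a)
    distinct u⟶v =
      ((λ ()) VecAll.∷ (λ ()) VecAll.∷ VecAll.[]) VecPairs.∷
      ((λ { refl → irrefl refl (sound u⟶v) }) VecAll.∷ VecAll.[]) VecPairs.∷
      VecAll.[] VecPairs.∷ VecPairs.[]

Colouring : ℕ → Set
Colouring m = Vec Bool m

_≟ᶜ_ : ∀ {m} → DecidableEquality (Colouring m)
_≟ᶜ_ = Vec.≡-dec Bool._≟_

_~_ : ∀ {m} → Rel (Colouring m) 0ℓ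
S ~ T = S ≡ T ⊎ S ≡ Vec.map not T

_~?_ : ∀ {m} → Decidable (_~_ {m})
S ~? T = (S ≟ᶜ T) ⊎-dec (S ≟ᶜ Vec.map not T)

module _ {m : ℕ} where

  colour : Colouring m → Triple m → Fin 3 → Bool
  colour S e j = lookup S (lookup e j)

  ConstantOn : Colouring m → Pred (Triple m) 0ℓ
  ConstantOn S e = ∀ i j → colour S e i ≡ colour S e j

  constantOn? : ∀ S → Unary.Decidable (ConstantOn S)
  constantOn? S e = Fin.all? λ i → Fin.all? λ j → colour S e i Bool.≟ colour S e j

  -- m_e(S) = j.  With two colours, both remaining vertices then share a
  -- colour; the condition is invariant under complementing S.
  Minority : Triple m → Fin 3 → Pred (Colouring m) 0ℓ
  Minority e j S = ∀ i → i ≢ j → colour S e i ≢ colour S e j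

  minority? : ∀ e j → Unary.Decidable (Minority e j)
  minority? e j S = Fin.all? λ i →
    ¬? (i Fin.≟ j) →-dec ¬? (colour S e i Bool.≟ colour S e j)

module _ {m : ℕ} (H : Hypergraph₃ m) where
  open Hypergraph₃ H

  Proper : Pred (Colouring m) 0ℓ
  Proper S = All (λ e → ¬ ConstantOn S e) hyperedges

  proper? : Unary.Decidable Proper
  proper? S = all? (λ e → ¬? (constantOn? S e)) hyperedges

  -- C(H), each complement class being listed once, through one of its
  -- two members.
  classes : List (Colouring m)
  classes = deduplicate _~?_ (filter proper? (boolVecs m))

  -- Only the values of q on the listed representatives matter.
  IsDistribution : Pred (Colouring m → ℚ) 0ℓ
  IsDistribution q = (∀ S → 0ℚ ≤ q S) × ∑ classes q ≡ 1ℚ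

  Pr[_,_↦_] : (Colouring m → ℚ) → Triple m → Fin 3 → ℚ
  Pr[ q , e ↦ j ] = ∑ (filter (minority? e j) classes) q

  IsMaxMinorityProbability : (Colouring m → ℚ) → Pred ℚ 0ℓ
  IsMaxMinorityProbability q = IsMaximum λ x →
    ∃[ e ] ∃[ j ] e List.∈ hyperedges × x ≡ Pr[ q , e ↦ j ]

  -- β(H) = x; no x qualifies when C(H) or the hyperedge set is empty.
  IsBeta : Pred ℚ 0ℓ
  IsBeta = IsMinimum λ x →
    ∃[ q ] IsDistribution q × IsMaxMinorityProbability q x

record Context (Obs : Set) : Set where
  field
    {arity} : ℕ
    scope   : Vec Obs arity
    table   : Vec Bool arity → ℚ

-- The observables of a model are the members of the list; the type Obs
-- may contain further, unused names.
record EmpiricalModel : Set₁ where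
  field
    {Obs}       : Set
    _≟_         : DecidableEquality Obs
    observables : List Obs
    unique      : Unique observables
    contexts    : List (Context Obs)
    inScope     : All (λ C → VecAll.All (List._∈ observables) (Context.scope C)) contexts

module _ (M : EmpiricalModel) where
  open EmpiricalModel M

  _[_≔_] : (Obs → Bool) → Obs → Bool → Obs → Bool
  (g [ o ≔ b ]) o′ = if does (o ≟ o′) then b else g o′

  -- All assignments of outcomes to the given observables, each extended
  -- by false to the unused names.
  assignmentsTo : List Obs → List (Obs → Bool)
  assignmentsTo []       = (λ _ → false) ∷ []
  assignmentsTo (o ∷ os) =
    concatMap (λ g → g [ o ≔ false ] ∷ g [ o ≔ true ] ∷ []) (assignmentsTo os)

  globalAssignments : List (Obs → Bool)
  globalAssignments = assignmentsTo observables

  RestrictsTo : (C : Context Obs) → Vec Bool (Context.arity C) → Pred (Obs → Bool) 0ℓ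
  RestrictsTo C u g = Vec.map g (Context.scope C) ≡ u

  restrictsTo? : ∀ C u → Unary.Decidable (RestrictsTo C u)
  restrictsTo? C u g = Vec.≡-dec Bool._≟_ (Vec.map g (Context.scope C)) u

  -- Only the values of b on the listed global assignments matter.
  IsSubmodel : Pred ((Obs → Bool) → ℚ) 0ℓ
  IsSubmodel b =
    (∀ g → 0ℚ ≤ b g) ×
    All (λ C → ∀ u → ∑ (filter (restrictsTo? C u) globalAssignments) b ≤ Context.table C u)
        contexts

  IsNCF : Pred ℚ 0ℓ
  IsNCF = IsMaximum λ x → ∃[ b ] IsSubmodel b × x ≡ ∑ globalAssignments b

uniformNAE₃ : Vec Bool 3 → ℚ
uniformNAE₃ (false ∷ false ∷ false ∷ []) = 0ℚ
uniformNAE₃ (true  ∷ true  ∷ true  ∷ []) = 0ℚ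
uniformNAE₃ _                            = + 1 / 6

perfectlyCorrelated : Vec Bool 2 → ℚ
perfectlyCorrelated (false ∷ false ∷ []) = ½
perfectlyCorrelated (true  ∷ true  ∷ []) = ½
perfectlyCorrelated _                    = 0ℚ

Observable : ℕ → Set
Observable m = Fin m ⊎ (Triple m × Fin 3)

pattern central v = inj₁ v
pattern fresh e j = inj₂ (e , j)

module _ {m : ℕ} (H : Hypergraph₃ m) where
  open Hypergraph₃ H

  NonIsolated : Pred (Fin m) 0ℓ
  NonIsolated v = Any (v Vec.∈_) hyperedges

  nonIsolated? : Unary.Decidable NonIsolated
  nonIsolated? v = any? (DecVec._∈?_ Fin._≟_ v) hyperedges

  centralVertices : List (Fin m)
  centralVertices = filter nonIsolated? (allFin m)

  freshCopies : List (Triple m × Fin 3)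
  freshCopies = cartesianProduct hyperedges (allFin 3)

  naeContext : Triple m → Context (Observable m)
  naeContext e = record
    { scope = Vec.map (λ j → fresh e j) (Vec.allFin 3)
    ; table = uniformNAE₃
    }

  copyContext : Triple m × Fin 3 → Context (Observable m)
  copyContext (e , j) = record
    { scope = central (lookup e j) ∷ fresh e j ∷ []
    ; table = perfectlyCorrelated
    }

  naeModel : EmpiricalModel
  naeModel = record
    { _≟_         = ⊎-≡-dec Fin._≟_ (×-≡-dec (Vec.≡-dec Fin._≟_) Fin._≟_)
    ; observables = map inj₁ centralVertices ++ map inj₂ freshCopies
    ; unique      = Unique.++⁺
        (Unique.map⁺ inj₁-injective (Unique.filter⁺ nonIsolated? (Unique.allFin⁺ m)))
        (Unique.map⁺ inj₂-injective (Unique.cartesianProduct⁺ unique (Unique.allFin⁺ 3)))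
        disjoint
    ; contexts    = map naeContext hyperedges ++ map copyContext freshCopies
    ; inScope     = All.++⁺
        (All.map⁺ (All.tabulate λ e∈ →
          fresh∈ e∈ zero VecAll.∷ fresh∈ e∈ (suc zero) VecAll.∷
          fresh∈ e∈ (suc (suc zero)) VecAll.∷ VecAll.[]))
        (All.map⁺ (All.tabulate λ {(e , j)} ej∈ →
          case List.∈-cartesianProduct⁻ hyperedges (allFin 3) ej∈ of λ (e∈ , _) →
          central∈ e∈ j VecAll.∷ fresh∈ e∈ j VecAll.∷ VecAll.[]))
    }
    where
    obs : List (Observable m)
    obs = map inj₁ centralVertices ++ map inj₂ freshCopies

    disjoint : ∀ {o} → ¬ (o List.∈ map inj₁ centralVertices × o List.∈ map inj₂ freshCopies)
    disjoint (p , q) with List.∈-map⁻ inj₁ p | List.∈-map⁻ inj₂ q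
    ... | _ , _ , refl | _ , _ , ()

    fresh∈ : ∀ {e} → e List.∈ hyperedges → ∀ j → fresh e j List.∈ obs
    fresh∈ e∈ j = List.∈-++⁺ʳ (map inj₁ centralVertices)
      (List.∈-map⁺ inj₂ (List.∈-cartesianProduct⁺ e∈ (List.∈-allFin j)))

    central∈ : ∀ {e} → e List.∈ hyperedges → ∀ j → central (lookup e j) List.∈ obs
    central∈ {e} e∈ j = List.∈-++⁺ˡ (List.∈-map⁺ inj₁
      (List.∈-filter⁺ nonIsolated? (List.∈-allFin (lookup e j))
        (List.lose e∈ (Vec.∈-lookup j e))))

{-# OPTIONS --safe #-}
-- Relative to the anchor r, a two-colouring S of A(G) is the set I of vertices
-- that share the colour of r, and S is proper exactly when I is independent.
-- For the edge (r,u,v) the minority position is u or v when I misses only u or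
-- only v, and r when it misses both.  Hence a distribution on colourings has
-- uniform minority positions on every edge iff the random independent set I
-- contains each vertex with probability 1/3, which after scaling by 3 is a
-- fractional colouring of weight 3 covering every vertex exactly once.  Any
-- fractional colouring of weight at most 3 becomes exact by deleting vertices
-- from its sets.  For the noncontextual fraction, flip a colouring by a fair
-- coin and copy the central outcomes to the fresh observables; conversely, the
-- zero entries of the tables force all copies to agree.  That χ_f exists as a
-- rational number follows from Fourier–Motzkin elimination.
module Submission where

open import Defs
open import Data.Nat.Base using (ℕ; zero; suc)
open import Data.Integer.Base using (+_)
open import Data.Product.Base using (_×_; _,_; ∃-syntax; proj₁; proj₂)
open import Data.Rational.Base
  using (ℚ; 0ℚ; 1ℚ; ½; _+_; _*_; -_; _-_; _≤_; _<_; _/_; _⊔_; _⊓_; 1/_;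
         Positive; positive; nonNegative; nonPositive)
open import Function.Bundles using (_⇔_; mk⇔; Equivalence)

open import Data.Bool.Base using (Bool; true; false; if_then_else_; not; _∧_)
import Data.Bool.Properties as Bool
open import Data.Empty using (⊥)
open import Data.Fin.Base using (Fin; zero; suc)
import Data.Fin.Properties as Fin
open import Data.Fin.Subset using (Subset; outside) renaming (_∈_ to _∈ₛ_; ⊥ to ∅)
open import Data.Fin.Subset.Properties using (_∈?_; ∉⊥)
open import Data.List.Base
  using (List; []; _∷_; _++_; map; concatMap; filter; allFin;
         cartesianProduct; cartesianProductWith; deduplicate)
open import Data.List.Membership.Propositional using (_∈_)
open import Data.List.Membership.Propositional.Properties
open import Data.List.Relation.Unary.All using (All; []; _∷_; all?)
import Data.List.Relation.Unary.All as All
import Data.List.Relation.Unary.All.Properties as All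
open import Data.List.Relation.Unary.AllPairs using (AllPairs; []; _∷_)
import Data.List.Relation.Unary.AllPairs as AllPairs
import Data.List.Relation.Unary.AllPairs.Properties as AllPairs
open import Data.List.Relation.Unary.Any using (Any; here; there)
import Data.List.Relation.Unary.Any as Any
import Data.List.Relation.Unary.Any.Properties as Any
open import Data.List.Relation.Unary.Unique.Propositional using (Unique)
import Data.List.Relation.Unary.Unique.Propositional.Properties as Unique
open import Data.Rational.Properties
open import Data.Rational.Solver using (module +-*-Solver)
open import Data.Sum.Base using (_⊎_; inj₁; inj₂)
open import Data.Vec.Base as Vec using (Vec; []; _∷_; lookup; _[_]≔_)
import Data.Vec.Properties as Vec
import Data.Vec.Relation.Unary.All as VecAll
open import Function.Base using (_∘_)
open import Level using (0ℓ)
open import Relation.Binary using (Rel; DecidableEquality; tri<; tri≈; tri>)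
import Relation.Binary as Binary
open import Relation.Binary.PropositionalEquality
open import Relation.Nullary using (¬_; ¬?; Dec; yes; no; does; contradiction)
open import Relation.Nullary.Decidable using (dec-true; dec-false; does-⇔; from-yes)
open import Relation.Unary using (Decidable)

open Equivalence using (to; from)

-- Finite sums

infixl 5 _when_
-- Indicator factor. Rewriting filtered sums as full sums of `when` terms lets sums be interchanged
-- and events be compared as Booleans.
_when_ : ℚ → Bool → ℚ
x when b = if b then x else 0ℚ

module _ {A : Set} where

  private variable
    f g : A → ℚ

  ∑-cong : ∀ xs → (∀ {x} → x ∈ xs → f x ≡ g x) → ∑ xs f ≡ ∑ xs g
  ∑-cong []       eq = refl
  ∑-cong (x ∷ xs) eq = cong₂ _+_ (eq (here refl)) (∑-cong xs (eq ∘ there))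

  ∑-mono : ∀ xs → (∀ {x} → x ∈ xs → f x ≤ g x) → ∑ xs f ≤ ∑ xs g
  ∑-mono []       le = ≤-refl
  ∑-mono (x ∷ xs) le = +-mono-≤ (le (here refl)) (∑-mono xs (le ∘ there))

  ∑-0 : ∀ (xs : List A) → ∑ xs (λ _ → 0ℚ) ≡ 0ℚ
  ∑-0 []       = refl
  ∑-0 (x ∷ xs) = trans (+-identityˡ _) (∑-0 xs)

  ∑-nonneg : ∀ xs → (∀ {x} → x ∈ xs → 0ℚ ≤ f x) → 0ℚ ≤ ∑ xs f
  ∑-nonneg xs nn = ≤-trans (≤-reflexive (sym (∑-0 xs))) (∑-mono xs nn)

  ∑-+ : ∀ xs → ∑ xs (λ (x : A) → f x + g x) ≡ ∑ xs f + ∑ xs g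
  ∑-+ []       = refl
  ∑-+ {f} {g} (x ∷ xs) rewrite ∑-+ {f} {g} xs =
    solve 4 (λ a b c d → (a :+ b) :+ (c :+ d) := (a :+ c) :+ (b :+ d)) refl
      (f x) (g x) (∑ xs f) (∑ xs g)
    where open +-*-Solver

  ∑-* : ∀ c xs → ∑ xs (λ (x : A) → c * f x) ≡ c * ∑ xs f
  ∑-* c []           = sym (*-zeroʳ c)
  ∑-* {f} c (x ∷ xs) = trans (cong (_+_ (c * f x)) (∑-* c xs)) (sym (*-distribˡ-+ c _ _))

  ∑-++ : ∀ xs {ys} → ∑ (xs ++ ys) f ≡ ∑ xs f + ∑ ys f
  ∑-++ []           = sym (+-identityˡ _)
  ∑-++ {f} (x ∷ xs) = trans (cong (_+_ (f x)) (∑-++ xs)) (sym (+-assoc (f x) _ _))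

  ∑-when : ∀ b xs → ∑ xs (λ (x : A) → f x when b) ≡ (∑ xs f when b)
  ∑-when true  xs = refl
  ∑-when false xs = ∑-0 xs

  ∑-filter : ∀ {P : A → Set} (P? : Decidable P) xs →
             ∑ (filter P? xs) f ≡ ∑ xs (λ x → f x when does (P? x))
  ∑-filter P? []       = refl
  ∑-filter {f} P? (x ∷ xs) with does (P? x)
  ... | true  = cong (_+_ (f x)) (∑-filter P? xs)
  ... | false = trans (∑-filter P? xs) (sym (+-identityˡ _))

  ∑-select-none : ∀ {R : A → Set} (R? : Decidable R) c xs → All (¬_ ∘ R) xs →
                  ∑ xs (λ x → c when does (R? x)) ≡ 0ℚ
  ∑-select-none R? c xs none = trans
    (∑-cong xs λ {x} x∈ → cong (c when_) (dec-false (R? x) (All.lookup none x∈)))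
    (∑-0 xs)

  -- Pairwise exclusion allows at most one entry with `R` and `Any` supplies one, so the constant is
  -- counted exactly once.
  ∑-select : ∀ {R : A → Set} (R? : Decidable R) c xs →
             AllPairs (λ x y → R x → ¬ R y) xs → Any R xs →
             ∑ xs (λ x → c when does (R? x)) ≡ c
  ∑-select R? c (x ∷ xs) (x# ∷ _) (here r)
    rewrite dec-true (R? x) r
    = trans (cong (_+_ c) (∑-select-none R? c xs (All.map (λ n → n r) x#))) (+-identityʳ c)
  ∑-select R? c (x ∷ xs) (x# ∷ xs#) (there a) with R? x
  ... | yes r = trans (cong (_+_ c) (∑-select-none R? c xs (All.map (λ n → n r) x#))) (+-identityʳ c)
  ... | no _  = trans (+-identityˡ _) (∑-select R? c xs xs# a)

  term≤∑ : ∀ {x} xs → (∀ y → 0ℚ ≤ f y) → x ∈ xs → f x ≤ ∑ xs f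
  term≤∑ {f} (x ∷ xs) nn (here refl) = ≤-trans (≤-reflexive (sym (+-identityʳ (f x))))
    (+-monoʳ-≤ (f x) (∑-nonneg xs λ {y} _ → nn y))
  term≤∑ {f} {y} (x ∷ xs) nn (there y∈) = ≤-trans (≤-reflexive (sym (+-identityˡ (f y))))
    (+-mono-≤ (nn x) (term≤∑ xs nn y∈))

module _ {A B : Set} where

  ∑-map : ∀ (h : A → B) xs {f : B → ℚ} → ∑ (map h xs) f ≡ ∑ xs (f ∘ h)
  ∑-map h []       = refl
  ∑-map h (x ∷ xs) {f} = cong (_+_ (f (h x))) (∑-map h xs)

  ∑-concatMap : ∀ (h : A → List B) xs {f : B → ℚ} →
                ∑ (concatMap h xs) f ≡ ∑ xs (λ x → ∑ (h x) f)
  ∑-concatMap h []           = refl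
  ∑-concatMap h (x ∷ xs) {f} = trans (∑-++ (h x)) (cong (_+_ (∑ (h x) f)) (∑-concatMap h xs))

  ∑-comm : ∀ xs ys {f : A → B → ℚ} →
           ∑ xs (λ x → ∑ ys (f x)) ≡ ∑ ys (λ y → ∑ xs (λ x → f x y))
  ∑-comm []       ys     = sym (∑-0 ys)
  ∑-comm (x ∷ xs) ys {f} = trans (cong (_+_ (∑ ys (f x))) (∑-comm xs ys)) (sym (∑-+ ys))

module _ {A B : Set} where

  -- Push-forward of the weight `f` along `R`. It carries weights between independent sets,
  -- colourings, global assignments and local outcomes.
  module Push {R : A → B → Set} (R? : ∀ x y → Dec (R x y)) (xs : List A) (f : A → ℚ) where

    push : B → ℚ
    push y = ∑ (filter (λ x → R? x y) xs) f

    push-nonneg : (∀ {x} → x ∈ xs → 0ℚ ≤ f x) → ∀ y → 0ℚ ≤ push y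
    push-nonneg nn y = ∑-nonneg (filter (λ x → R? x y) xs)
      (nn ∘ proj₁ ∘ ∈-filter⁻ (λ x → R? x y) {xs = xs})

    -- Interchange of summation. The first hypothesis says that the weight of each `x` arrives in
    -- `ys` exactly once; the last says that the events `p` and `q` correspond under `R`.
    ∑-push : ∀ ys → (∀ {x} → x ∈ xs → ∑ ys (λ y → f x when does (R? x y)) ≡ f x) →
             (p : B → Bool) (q : A → Bool) →
             (∀ {x y} → x ∈ xs → y ∈ ys → R x y → p y ≡ q x) →
             ∑ ys (λ y → push y when p y) ≡ ∑ xs (λ x → f x when q x)
    ∑-push ys rep p q compat = begin
      ∑ ys (λ y → push y when p y)
        ≡⟨ ∑-cong ys (λ {y} _ → trans (cong (_when p y) (∑-filter (λ x → R? x y) xs)) (sym (∑-when (p y) xs))) ⟩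
      ∑ ys (λ y → ∑ xs (λ x → f x when does (R? x y) when p y))
        ≡⟨ ∑-comm ys xs ⟩
      ∑ xs (λ x → ∑ ys (λ y → f x when does (R? x y) when p y))
        ≡⟨ ∑-cong xs (λ {x} x∈ → trans (∑-cong ys (swap x∈)) (trans (∑-when (q x) ys) (cong (_when q x) (rep x∈)))) ⟩
      ∑ xs (λ x → f x when q x) ∎
      where
      open ≡-Reasoning
      swap : ∀ {x y} → x ∈ xs → y ∈ ys →
             (f x when does (R? x y) when p y) ≡ (f x when does (R? x y) when q x)
      swap {x} {y} x∈ y∈ with R? x y
      ... | yes r = cong (f x when_) (compat x∈ y∈ r)
      ... | no _ with p y | q x
      ... | true  | true  = refl
      ... | true  | false = refl
      ... | false | true  = refl
      ... | false | false = refl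

-- Linear inequalities over ℚ

p≤q⇒0≤q-p : ∀ {p q} → p ≤ q → 0ℚ ≤ q - p
p≤q⇒0≤q-p {p} {q} p≤q = ≤-trans (≤-reflexive (sym (+-inverseʳ p))) (+-monoˡ-≤ (- p) p≤q)

0≤q-p⇒p≤q : ∀ {p q} → 0ℚ ≤ q - p → p ≤ q
0≤q-p⇒p≤q {p} {q} 0≤ = begin
  p             ≡⟨ +-identityˡ p ⟨
  0ℚ + p        ≤⟨ +-monoˡ-≤ p 0≤ ⟩
  q - p + p     ≡⟨ solve 2 (λ p q → q :- p :+ p := q) refl p q ⟩
  q             ∎
  where
  open ≤-Reasoning
  open +-*-Solver

0≤-cong-scale : ∀ {k x y} → 0ℚ < k → y ≡ k * x → 0ℚ ≤ x ⇔ 0ℚ ≤ y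
0≤-cong-scale {k} {x} {y} 0<k refl = mk⇔
  (λ 0≤x → ≤-trans (≤-reflexive (sym (*-zeroʳ k))) (*-monoˡ-≤-nonNeg k {{pos⇒nonNeg k {{positive 0<k}}}} 0≤x))
  (λ 0≤y → *-cancelˡ-≤-pos k {{positive 0<k}} (≤-trans (≤-reflexive (*-zeroʳ k)) 0≤y))

positive-inverse : ∀ {a} → 0ℚ < a → ∃[ i ] 0ℚ < i × i * a ≡ 1ℚ
positive-inverse {a} 0<a = 1/ a , positive⁻¹ (1/ a) {{1/pos⇒pos a}} , *-inverseˡ a
  where instance
    pos : Positive a
    pos = positive 0<a
    nz = pos⇒nonZero a

-- Solving for `y` gives `k` = -1/a. It is independent of `r`, so multiplying an affine form by `k`
-- yields the bound as an affine form again.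
lower-bound : ∀ {a} → 0ℚ < a → ∃[ k ] ∀ y r → 0ℚ ≤ a * y + r ⇔ k * r ≤ y
lower-bound {a} 0<a with positive-inverse 0<a
... | i , 0<i , ia≡1 = - i , λ y r →
  let eq = begin
        y - (- i) * r      ≡⟨ solve 3 (λ y i r → y :- (:- i) :* r := con 1ℚ :* y :+ i :* r) refl y i r ⟩
        1ℚ * y + i * r     ≡⟨ cong (λ z → z * y + i * r) ia≡1 ⟨
        i * a * y + i * r  ≡⟨ solve 4 (λ a y i r → i :* a :* y :+ i :* r := i :* (a :* y :+ r)) refl a y i r ⟩
        i * (a * y + r)    ∎
  in mk⇔ (0≤q-p⇒p≤q ∘ to (0≤-cong-scale 0<i eq)) (from (0≤-cong-scale 0<i eq) ∘ p≤q⇒0≤q-p)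
  where
  open ≡-Reasoning
  open +-*-Solver

upper-bound : ∀ {a} → a < 0ℚ → ∃[ k ] ∀ y r → 0ℚ ≤ a * y + r ⇔ y ≤ k * r
upper-bound {a} a<0 with positive-inverse (neg-antimono-< a<0)
... | i , 0<i , ia≡1 = i , λ y r →
  let eq = begin
        i * r - y            ≡⟨ solve 3 (λ y i r → i :* r :- y := i :* r :- con 1ℚ :* y) refl y i r ⟩
        i * r - 1ℚ * y       ≡⟨ cong (λ z → i * r - z * y) ia≡1 ⟨
        i * r - i * - a * y  ≡⟨ solve 4 (λ a y i r → i :* r :- i :* (:- a) :* y := i :* (a :* y :+ r)) refl a y i r ⟩
        i * (a * y + r)      ∎
  in mk⇔ (0≤q-p⇒p≤q ∘ to (0≤-cong-scale 0<i eq)) (from (0≤-cong-scale 0<i eq) ∘ p≤q⇒0≤q-p)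
  where
  open ≡-Reasoning
  open +-*-Solver

-- Start from the minimum of 0 and all upper bounds, then raise this point to each lower bound in
-- turn; the pairwise inequalities keep it below the upper bounds.
interpolate : ∀ {A : Set} (f : A → ℚ) ls us → All (λ l → All (λ u → f l ≤ f u) us) ls →
              ∃[ y ] All (λ l → f l ≤ y) ls × All (λ u → y ≤ f u) us
interpolate f []       []       [] = 0ℚ , [] , []
interpolate f []       (u ∷ us) [] with interpolate f [] us []
... | y , _ , y≤ = f u ⊓ y , [] , p⊓q≤p (f u) y ∷ All.map (≤-trans (p⊓q≤q (f u) y)) y≤
interpolate f (l ∷ ls) us (l≤ ∷ ls≤) with interpolate f ls us ls≤
... | y , ≤y , y≤ =
  f l ⊔ y ,
  p≤p⊔q (f l) y ∷ All.map (λ z≤y → ≤-trans z≤y (p≤q⊔p (f l) y)) ≤y ,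
  All.zipWith (λ (p , q) → ⊔-lub p q) (l≤ , y≤)

-- Linear programs and Fourier-Motzkin elimination

module LinearProgram {V : Set} (_≟ᵛ_ : DecidableEquality V) where

  -- The parameter t carries the objective; it is never eliminated.
  record Affine : Set where
    constructor affine
    field
      coeff          : V → ℚ
      slope constant : ℚ

  -- Only variables in the list contribute, so eliminating a variable means evaluating over a
  -- shorter list; its coefficient need not be erased.
  ⟦_⟧ : Affine → List V → (V → ℚ) → ℚ → ℚ
  ⟦ affine a s c ⟧ vs w t = ∑ vs (λ v → a v * w v) + (s * t + c)

  _⊙_ : ℚ → Affine → Affine
  k ⊙ affine a s c = affine (λ v → k * a v) (k * s) (k * c)

  _⊝_ : Affine → Affine → Affine
  affine a s c ⊝ affine a′ s′ c′ = affine (λ v → a v + - 1ℚ * a′ v) (s - s′) (c - c′)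

  ⟦⊙⟧ : ∀ k φ vs w t → ⟦ k ⊙ φ ⟧ vs w t ≡ k * ⟦ φ ⟧ vs w t
  ⟦⊙⟧ k (affine a s c) vs w t = begin
    ∑ vs (λ v → k * a v * w v) + (k * s * t + k * c)
      ≡⟨ cong (_+ _) (trans (∑-cong vs λ {v} _ → *-assoc k (a v) (w v)) (∑-* k vs)) ⟩
    k * S + (k * s * t + k * c)
      ≡⟨ solve 5 (λ k S s t c → k :* S :+ (k :* s :* t :+ k :* c) := k :* (S :+ (s :* t :+ c))) refl k S s t c ⟩
    k * (S + (s * t + c)) ∎
    where
    open ≡-Reasoning
    open +-*-Solver
    S = ∑ vs (λ v → a v * w v)

  ⟦⊝⟧ : ∀ φ ψ vs w t → ⟦ φ ⊝ ψ ⟧ vs w t ≡ ⟦ φ ⟧ vs w t - ⟦ ψ ⟧ vs w t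
  ⟦⊝⟧ (affine a s c) (affine a′ s′ c′) vs w t = begin
    ∑ vs (λ v → (a v + - 1ℚ * a′ v) * w v) + ((s - s′) * t + (c - c′))
      ≡⟨ cong (_+ _) (∑-cong vs λ {v} _ →
           solve 3 (λ a a′ w → (a :+ :- con 1ℚ :* a′) :* w := a :* w :+ :- con 1ℚ :* (a′ :* w)) refl
             (a v) (a′ v) (w v)) ⟩
    ∑ vs (λ v → a v * w v + - 1ℚ * (a′ v * w v)) + ((s - s′) * t + (c - c′))
      ≡⟨ cong (_+ _) (trans (∑-+ vs) (cong (_+_ S) (∑-* (- 1ℚ) vs))) ⟩
    S + - 1ℚ * S′ + ((s - s′) * t + (c - c′))
      ≡⟨ solve 7 (λ S S′ s s′ c c′ t →
           S :+ :- con 1ℚ :* S′ :+ ((s :- s′) :* t :+ (c :- c′)) :=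
           (S :+ (s :* t :+ c)) :- (S′ :+ (s′ :* t :+ c′))) refl S S′ s s′ c c′ t ⟩
    S + (s * t + c) - (S′ + (s′ * t + c′)) ∎
    where
    open ≡-Reasoning
    open +-*-Solver
    S = ∑ vs (λ v → a v * w v)
    S′ = ∑ vs (λ v → a′ v * w v)

  Feasible : List V → List Affine → (V → ℚ) → ℚ → Set
  Feasible vs Φ w t = All (λ φ → 0ℚ ≤ ⟦ φ ⟧ vs w t) Φ

  -- Constraints sorted by the sign of the coefficient of `x`: a positive one becomes a lower bound
  -- on `w x`, a negative one an upper bound, and a zero one stays as it is. All three kinds are
  -- evaluated over `vs` alone.
  record Split (x : V) (vs : List V) (Φ : List Affine) : Set where
    field
      lowers uppers frees : List Affine
      split : ∀ w t → Feasible (x ∷ vs) Φ w t ⇔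
        (All (λ l → ⟦ l ⟧ vs w t ≤ w x) lowers ×
         All (λ u → w x ≤ ⟦ u ⟧ vs w t) uppers ×
         Feasible vs frees w t)

  ⟦⟧-∷ : ∀ φ x vs w t → ⟦ φ ⟧ (x ∷ vs) w t ≡ Affine.coeff φ x * w x + ⟦ φ ⟧ vs w t
  ⟦⟧-∷ (affine a s c) x vs w t = +-assoc (a x * w x) _ _

  splitting : ∀ x vs Φ → Split x vs Φ
  splitting x vs [] = record
    { lowers = [] ; uppers = [] ; frees = []
    ; split = λ w t → mk⇔ (λ _ → [] , [] , []) (λ _ → []) }
  splitting x vs (φ ∷ Φ) with splitting x vs Φ | <-cmp (Affine.coeff φ x) 0ℚ
  ... | s | tri< a<0 _ _ = record
    { Split s ; uppers = k ⊙ φ ∷ uppers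
    ; split = λ w t → mk⇔
        (λ { (h ∷ hs) → let ls , us , fs = to (split w t) hs in
             ls ,
             subst (w x ≤_) (sym (⟦⊙⟧ k φ vs w t)) (to (bound _ _) (subst (0ℚ ≤_) (⟦⟧-∷ φ x vs w t) h)) ∷ us ,
             fs })
        (λ { (ls , u ∷ us , fs) →
             subst (0ℚ ≤_) (sym (⟦⟧-∷ φ x vs w t)) (from (bound _ _) (subst (w x ≤_) (⟦⊙⟧ k φ vs w t) u))
             ∷ from (split w t) (ls , us , fs) }) }
    where
    open Split s
    k = proj₁ (upper-bound a<0)
    bound = proj₂ (upper-bound a<0)
  ... | s | tri> _ _ 0<a = record
    { Split s ; lowers = k ⊙ φ ∷ lowers
    ; split = λ w t → mk⇔
        (λ { (h ∷ hs) → let ls , us , fs = to (split w t) hs in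
             subst (_≤ w x) (sym (⟦⊙⟧ k φ vs w t)) (to (bound _ _) (subst (0ℚ ≤_) (⟦⟧-∷ φ x vs w t) h)) ∷ ls ,
             us , fs })
        (λ { (l ∷ ls , us , fs) →
             subst (0ℚ ≤_) (sym (⟦⟧-∷ φ x vs w t)) (from (bound _ _) (subst (_≤ w x) (⟦⊙⟧ k φ vs w t) l))
             ∷ from (split w t) (ls , us , fs) }) }
    where
    open Split s
    k = proj₁ (lower-bound 0<a)
    bound = proj₂ (lower-bound 0<a)
  ... | s | tri≈ _ a≡0 _ = record
    { Split s ; frees = φ ∷ frees
    ; split = λ w t → mk⇔
        (λ { (h ∷ hs) → let ls , us , fs = to (split w t) hs in ls , us , subst (0ℚ ≤_) (drop w t) h ∷ fs })
        (λ { (ls , us , f ∷ fs) → subst (0ℚ ≤_) (sym (drop w t)) f ∷ from (split w t) (ls , us , fs) }) }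
    where
    open Split s
    drop : ∀ w t → ⟦ φ ⟧ (x ∷ vs) w t ≡ ⟦ φ ⟧ vs w t
    drop w t = begin
      ⟦ φ ⟧ (x ∷ vs) w t                   ≡⟨ ⟦⟧-∷ φ x vs w t ⟩
      Affine.coeff φ x * w x + ⟦ φ ⟧ vs w t ≡⟨ cong (λ a → a * w x + ⟦ φ ⟧ vs w t) a≡0 ⟩
      0ℚ * w x + ⟦ φ ⟧ vs w t              ≡⟨ cong (_+ _) (*-zeroˡ (w x)) ⟩
      0ℚ + ⟦ φ ⟧ vs w t                    ≡⟨ +-identityˡ _ ⟩
      ⟦ φ ⟧ vs w t                         ∎
      where open ≡-Reasoning

  _[_↦_] : (V → ℚ) → V → ℚ → V → ℚ
  (w [ x ↦ y ]) v = if does (v ≟ᵛ x) then y else w v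

  ⟦⟧-update : ∀ {x vs} → All (x ≢_) vs → ∀ φ w y t → ⟦ φ ⟧ vs (w [ x ↦ y ]) t ≡ ⟦ φ ⟧ vs w t
  ⟦⟧-update {x} {vs} x∉ (affine a s c) w y t = cong (_+ _) (∑-cong vs λ {v} v∈ →
    cong (λ b → a v * (if b then y else w v)) (dec-false (v ≟ᵛ x) (All.lookup x∉ v∈ ∘ sym)))

  -- `t` is fixed in both directions, while `w` may be replaced in the second: what has to survive
  -- elimination is the set of feasible values of `t`.
  Projection : List V → List V → List Affine → Set
  Projection vs us Φ = ∃[ Ψ ]
    (∀ w t → Feasible vs Φ w t → Feasible us Ψ w t) ×
    (∀ w t → Feasible us Ψ w t → ∃[ w′ ] Feasible vs Φ w′ t)

  -- One step of Fourier–Motzkin elimination.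
  eliminate : ∀ {x vs Φ} → All (x ≢_) vs → Split x vs Φ → Projection (x ∷ vs) vs Φ
  eliminate {x} {vs} {Φ} x∉ s = frees ++ gaps , sound , complete
    where
    open Split s
    -- Each pair of a lower and an upper bound contributes the constraint that their difference is
    -- nonnegative.
    gaps = cartesianProductWith (λ l u → u ⊝ l) lowers uppers

    sound : ∀ w t → Feasible (x ∷ vs) Φ w t → Feasible vs (frees ++ gaps) w t
    sound w t h = All.++⁺ fs (All.tabulate go)
      where
      ls = proj₁ (to (split w t) h)
      us = proj₁ (proj₂ (to (split w t) h))
      fs = proj₂ (proj₂ (to (split w t) h))
      go : ∀ {φ} → φ ∈ gaps → 0ℚ ≤ ⟦ φ ⟧ vs w t
      go φ∈ with ∈-cartesianProductWith⁻ (λ l u → u ⊝ l) lowers uppers φ∈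
      ... | l , u , l∈ , u∈ , refl = subst (0ℚ ≤_) (sym (⟦⊝⟧ u l vs w t))
        (p≤q⇒0≤q-p (≤-trans (All.lookup ls l∈) (All.lookup us u∈)))

    complete : ∀ w t → Feasible vs (frees ++ gaps) w t → ∃[ w′ ] Feasible (x ∷ vs) Φ w′ t
    complete w t h = w′ , from (split w′ t)
      ( All.map (λ {l} → subst₂ _≤_ (sym (⟦⟧-update x∉ l w y t)) (sym w′x)) (proj₁ (proj₂ middle))
      , All.map (λ {u} → subst₂ _≤_ (sym w′x) (sym (⟦⟧-update x∉ u w y t))) (proj₂ (proj₂ middle))
      , All.map (λ {f} → subst (0ℚ ≤_) (sym (⟦⟧-update x∉ f w y t))) (All.++⁻ˡ frees h))
      where
      middle = interpolate (λ φ → ⟦ φ ⟧ vs w t) lowers uppers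
        (All.tabulate λ {l} l∈ → All.tabulate λ {u} u∈ → 0≤q-p⇒p≤q
          (subst (0ℚ ≤_) (⟦⊝⟧ u l vs w t)
            (All.lookup (All.++⁻ʳ frees h) (∈-cartesianProductWith⁺ (λ l u → u ⊝ l) l∈ u∈))))
      y = proj₁ middle
      w′ = w [ x ↦ y ]
      w′x : w′ x ≡ y
      w′x = cong (λ b → if b then y else w x) (dec-true (x ≟ᵛ x) refl)

  project : ∀ {vs} → Unique vs → ∀ Φ → Projection vs [] Φ
  project []           Φ = Φ , (λ _ _ h → h) , (λ w _ h → w , h)
  project {x ∷ vs} (x∉ ∷ vs!) Φ =
    let Φ′ , sound , complete   = eliminate x∉ (splitting x vs Φ)
        Ψ  , sound′ , complete′ = project vs! Φ′
    in  Ψ , (λ w t h → sound′ w t (sound w t h)) ,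
        (λ w t h → let w′ , h′ = complete′ w t h in complete w′ t h′)

  -- Without variables a constraint reads s t + c ≥ 0. For s > 0 it bounds `t` from below;
  -- otherwise, holding at `t₀`, it holds for every smaller `t`. So `m` is the maximum of 0 and the
  -- lower bounds, and everything from `m` to `t₀` is feasible.
  least-parameter : ∀ Ψ w t₀ → 0ℚ ≤ t₀ → Feasible [] Ψ w t₀ → ∃[ m ] m ≤ t₀ ×
    (∀ t → m ≤ t → t ≤ t₀ → Feasible [] Ψ w t) ×
    (∀ w′ t → 0ℚ ≤ t → Feasible [] Ψ w′ t → m ≤ t)
  least-parameter [] w t₀ 0≤t₀ [] = 0ℚ , 0≤t₀ , (λ _ _ _ → []) , (λ _ _ 0≤t _ → 0≤t)
  least-parameter (affine a s c ∷ Ψ) w t₀ 0≤t₀ (h ∷ hs)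
    with least-parameter Ψ w t₀ 0≤t₀ hs | 0ℚ <? s
  ... | m , m≤t₀ , feasible , least | yes 0<s =
    m ⊔ k * c ,
    ⊔-lub m≤t₀ (to (bound t₀ c) (subst (0ℚ ≤_) (+-identityˡ _) h)) ,
    (λ t m⊔≤t t≤t₀ →
      subst (0ℚ ≤_) (sym (+-identityˡ _)) (from (bound t c) (≤-trans (p≤q⊔p m (k * c)) m⊔≤t))
      ∷ feasible t (≤-trans (p≤p⊔q m (k * c)) m⊔≤t) t≤t₀) ,
    (λ { w′ t 0≤t (h′ ∷ hs′) → ⊔-lub (least w′ t 0≤t hs′) (to (bound t c) (subst (0ℚ ≤_) (+-identityˡ _) h′)) })
    where
    k = proj₁ (lower-bound 0<s)
    bound = proj₂ (lower-bound 0<s)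
  ... | m , m≤t₀ , feasible , least | no s≤0 =
    m , m≤t₀ ,
    (λ t m≤t t≤t₀ →
      ≤-trans h (+-monoʳ-≤ 0ℚ (+-monoˡ-≤ c (*-monoˡ-≤-nonPos s {{nonPositive (≮⇒≥ s≤0)}} t≤t₀)))
      ∷ feasible t m≤t t≤t₀) ,
    (λ { w′ t 0≤t (_ ∷ hs′) → least w′ t 0≤t hs′ })

  abstract
    -- Eliminating all variables leaves constraints on `t` alone, whose least solution is rational
    -- and lifts back to a feasible point. The block is abstract so that the elimination is not
    -- unfolded by later conversion checks.
    minimum : ∀ {vs} → Unique vs → ∀ Φ {w₀ t₀} → Feasible vs Φ w₀ t₀ →
              (∀ w t → Feasible vs Φ w t → 0ℚ ≤ t) →
              ∃[ t ] IsMinimum (λ t → ∃[ w ] Feasible vs Φ w t) t × t ≤ t₀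
    minimum vs! Φ {w₀} {t₀} h₀ nonneg with project vs! Φ
    ... | Ψ , sound , lift with least-parameter Ψ w₀ t₀ (nonneg w₀ t₀ h₀) (sound w₀ t₀ h₀)
    ... | m , m≤t₀ , feasible , least =
      m , (lift w₀ m (feasible m ≤-refl m≤t₀) ,
           λ { t (w , h) → least w t (nonneg w t h) (sound w t h) }) , m≤t₀

-- Existence of the fractional chromatic number

∈-boolVecs : ∀ {n} (xs : Vec Bool n) → xs ∈ boolVecs n
∈-boolVecs []           = here refl
∈-boolVecs (false ∷ xs) = ∈-++⁺ˡ (∈-map⁺ (false ∷_) (∈-boolVecs xs))
∈-boolVecs (true ∷ xs)  = ∈-++⁺ʳ _ (∈-map⁺ (true ∷_) (∈-boolVecs xs))

boolVecs-unique : ∀ n → Unique (boolVecs n)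
boolVecs-unique zero    = [] ∷ []
boolVecs-unique (suc n) = Unique.++⁺
  (Unique.map⁺ Vec.∷-injectiveʳ (boolVecs-unique n))
  (Unique.map⁺ Vec.∷-injectiveʳ (boolVecs-unique n))
  λ (p , q) → case p q
  where
  case : ∀ {xs} → xs ∈ map (false ∷_) (boolVecs n) → ¬ xs ∈ map (true ∷_) (boolVecs n)
  case p q with ∈-map⁻ (false ∷_) p | ∈-map⁻ (true ∷_) q
  ... | _ , _ , refl | _ , _ , ()

∑-≡ : ∀ {n} c (x : Vec Bool n) {xs} → Unique xs → x ∈ xs →
      ∑ xs (λ y → c when does (x ≟ᶜ y)) ≡ c
∑-≡ c x {xs} xs! x∈ = ∑-select (x ≟ᶜ_) c xs
  (AllPairs.map (λ y≢z x≡y x≡z → y≢z (trans (sym x≡y) x≡z)) xs!) x∈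

does-∈? : ∀ {n} (v : Fin n) I → does (v ∈? I) ≡ lookup I v
does-∈? zero    (true ∷ I)  = refl
does-∈? zero    (false ∷ I) = refl
does-∈? (suc v) (_ ∷ I)     = does-∈? v I

when-* : ∀ c b x → (c when b) * x ≡ (c * x when b)
when-* c true  x = refl
when-* c false x = *-zeroˡ x

module _ {n : ℕ} (G : SimpleGraph n) where

  independentSets-unique : Unique (independentSets G)
  independentSets-unique = Unique.filter⁺ (independent? G) (boolVecs-unique n)

  ∈-independentSets : ∀ {I} → Independent G I → I ∈ independentSets G
  ∈-independentSets {I} = ∈-filter⁺ (independent? G) (∈-boolVecs I)

  independentSets-independent : ∀ {I} → I ∈ independentSets G → Independent G I
  independentSets-independent I∈ = proj₂ (∈-filter⁻ (independent? G) {xs = boolVecs n} I∈)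

  coverage : ∀ v w → ∑ (filter (v ∈?_) (independentSets G)) w ≡
                     ∑ (independentSets G) (λ I → w I when lookup I v)
  coverage v w = trans (∑-filter (v ∈?_) (independentSets G))
    (∑-cong (independentSets G) λ {I} _ → cong (w I when_) (does-∈? v I))

  private
    open LinearProgram (_≟ᶜ_ {n})

    ind : Subset n → Bool
    ind I = does (independent? G I)

    -- Encodes that the total weight is at most `t`, so that minimising `t` minimises the weight.
    -- The variables are all subsets; `ind` gives those that are not independent coefficient zero.
    objective : Affine
    objective = affine (λ I → - 1ℚ when ind I) 1ℚ 0ℚ

    covers : Fin n → Affine
    covers v = affine (λ I → 1ℚ when lookup I v when ind I) 0ℚ (- 1ℚ)

    nonneg : Subset n → Affine
    nonneg J = affine (λ I → 1ℚ when does (J ≟ᶜ I)) 0ℚ 0ℚ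

    constraints : List Affine
    constraints = objective ∷ map covers (allFin n) ++ map nonneg (boolVecs n)

    ⟦objective⟧ : ∀ w t → ⟦ objective ⟧ (boolVecs n) w t ≡ t - ∑ (independentSets G) w
    ⟦objective⟧ w t = begin
      ∑ (boolVecs n) (λ I → (- 1ℚ when ind I) * w I) + (1ℚ * t + 0ℚ)
        ≡⟨ cong (_+ (1ℚ * t + 0ℚ)) (∑-cong (boolVecs n) λ {I} _ → when-* (- 1ℚ) (ind I) (w I)) ⟩
      ∑ (boolVecs n) (λ I → - 1ℚ * w I when ind I) + (1ℚ * t + 0ℚ)
        ≡⟨ cong (_+ (1ℚ * t + 0ℚ)) (∑-filter (independent? G) (boolVecs n)) ⟨
      ∑ (independentSets G) (λ I → - 1ℚ * w I) + (1ℚ * t + 0ℚ)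
        ≡⟨ cong (_+ (1ℚ * t + 0ℚ)) (∑-* (- 1ℚ) (independentSets G)) ⟩
      - 1ℚ * ∑ (independentSets G) w + (1ℚ * t + 0ℚ)
        ≡⟨ solve 2 (λ s t → :- con 1ℚ :* s :+ (con 1ℚ :* t :+ con 0ℚ) := t :- s) refl (∑ (independentSets G) w) t ⟩
      t - ∑ (independentSets G) w ∎
      where
      open ≡-Reasoning
      open +-*-Solver

    ⟦covers⟧ : ∀ v w t → ⟦ covers v ⟧ (boolVecs n) w t ≡
               ∑ (filter (v ∈?_) (independentSets G)) w - 1ℚ
    ⟦covers⟧ v w t = begin
      ∑ (boolVecs n) (λ I → (1ℚ when lookup I v when ind I) * w I) + (0ℚ * t + - 1ℚ)
        ≡⟨ cong (_+ (0ℚ * t + - 1ℚ)) (∑-cong (boolVecs n) λ {I} _ → weight I) ⟩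
      ∑ (boolVecs n) (λ I → w I when lookup I v when ind I) + (0ℚ * t + - 1ℚ)
        ≡⟨ cong (_+ (0ℚ * t + - 1ℚ)) (∑-filter (independent? G) (boolVecs n)) ⟨
      ∑ (independentSets G) (λ I → w I when lookup I v) + (0ℚ * t + - 1ℚ)
        ≡⟨ cong₂ _+_ (sym (coverage v w)) (solve 1 (λ t → con 0ℚ :* t :+ :- con 1ℚ := :- con 1ℚ) refl t) ⟩
      ∑ (filter (v ∈?_) (independentSets G)) w - 1ℚ ∎
      where
      open ≡-Reasoning
      open +-*-Solver
      weight : ∀ I → (1ℚ when lookup I v when ind I) * w I ≡ (w I when lookup I v when ind I)
      weight I = trans (when-* (1ℚ when lookup I v) (ind I) (w I))
        (cong (_when ind I) (trans (when-* 1ℚ (lookup I v) (w I)) (cong (_when lookup I v) (*-identityˡ (w I)))))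

    ⟦nonneg⟧ : ∀ J w t → ⟦ nonneg J ⟧ (boolVecs n) w t ≡ w J
    ⟦nonneg⟧ J w t = begin
      ∑ (boolVecs n) (λ I → (1ℚ when does (J ≟ᶜ I)) * w I) + (0ℚ * t + 0ℚ)
        ≡⟨ cong (_+ (0ℚ * t + 0ℚ)) (∑-cong (boolVecs n) λ {I} _ → weight I) ⟩
      ∑ (boolVecs n) (λ I → w J when does (J ≟ᶜ I)) + (0ℚ * t + 0ℚ)
        ≡⟨ cong (_+ (0ℚ * t + 0ℚ)) (∑-≡ (w J) J (boolVecs-unique n) (∈-boolVecs J)) ⟩
      w J + (0ℚ * t + 0ℚ)
        ≡⟨ solve 2 (λ w t → w :+ (con 0ℚ :* t :+ con 0ℚ) := w) refl (w J) t ⟩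
      w J ∎
      where
      open ≡-Reasoning
      open +-*-Solver
      weight : ∀ I → (1ℚ when does (J ≟ᶜ I)) * w I ≡ (w J when does (J ≟ᶜ I))
      weight I with J ≟ᶜ I
      ... | yes refl = *-identityˡ (w J)
      ... | no _     = *-zeroˡ (w I)

    colouring-feasible : ∀ {w} → IsFractionalColouring G w → ∀ {t} → ∑ (independentSets G) w ≤ t →
                         Feasible (boolVecs n) constraints w t
    colouring-feasible {w} (w≥0 , cover) {t} ≤t =
      subst (0ℚ ≤_) (sym (⟦objective⟧ w t)) (p≤q⇒0≤q-p ≤t) ∷
      All.++⁺
        (All.map⁺ {P = satisfied} {xs = allFin n} {f = covers}
          (All.tabulate λ {v} _ → subst (0ℚ ≤_) (sym (⟦covers⟧ v w t)) (p≤q⇒0≤q-p (cover v))))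
        (All.map⁺ {P = satisfied} {xs = boolVecs n} {f = nonneg}
          (All.tabulate λ {I} _ → subst (0ℚ ≤_) (sym (⟦nonneg⟧ I w t)) (w≥0 I)))
      where
      satisfied : Affine → Set
      satisfied φ = 0ℚ ≤ ⟦ φ ⟧ (boolVecs n) w t

    feasible-colouring : ∀ {w t} → Feasible (boolVecs n) constraints w t →
                         IsFractionalColouring G w × ∑ (independentSets G) w ≤ t
    feasible-colouring {w} {t} (obj ∷ hs) =
      ( (λ I → subst (0ℚ ≤_) (⟦nonneg⟧ I w t)
          (All.lookup hs (∈-++⁺ʳ (map covers (allFin n)) (∈-map⁺ nonneg (∈-boolVecs I)))))
      , (λ v → 0≤q-p⇒p≤q (subst (0ℚ ≤_) (⟦covers⟧ v w t)
          (All.lookup hs (∈-++⁺ˡ (∈-map⁺ covers (∈-allFin v)))))) )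
      , 0≤q-p⇒p≤q (subst (0ℚ ≤_) (⟦objective⟧ w t) obj)

  chromatic-number-exists : ∀ {w} → IsFractionalColouring G w →
    ∃[ χ ] IsFractionalChromaticNumber G χ × χ ≤ ∑ (independentSets G) w
  chromatic-number-exists {w} col = χ , ((w′ , col′ , χ≡) , optimal) , proj₂ (proj₂ lp)
    where
    lp = minimum (boolVecs-unique n) constraints (colouring-feasible col ≤-refl)
           (λ w t h → ≤-trans
             (∑-nonneg (independentSets G) λ {I} _ → proj₁ (proj₁ (feasible-colouring h)) I)
             (proj₂ (feasible-colouring h)))
    χ = proj₁ lp
    w′ = proj₁ (proj₁ (proj₁ (proj₂ lp)))
    h′ = proj₂ (proj₁ (proj₁ (proj₂ lp)))
    col′ = proj₁ (feasible-colouring h′)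
    optimal : ∀ y → ∃[ w ] IsFractionalColouring G w × y ≡ ∑ (independentSets G) w → χ ≤ y
    optimal y (w , col , refl) = proj₂ (proj₁ (proj₂ lp)) y (w , colouring-feasible col ≤-refl)
    -- The objective constraint is tight at the minimum, since the total weight of `w′` is itself a
    -- feasible value of `t`.
    χ≡ : χ ≡ ∑ (independentSets G) w′
    χ≡ = ≤-antisym (optimal _ (w′ , col′ , refl)) (proj₂ (feasible-colouring h′))

-- Uniform fractional colourings

⅓ : ℚ
⅓ = + 1 / 3

3ℚ : ℚ
3ℚ = + 3 / 1

-- A list of atoms in which a set may recur, so that splitting an atom is a local operation; equal
-- sets are merged only in `normalise`.
Measure : ℕ → Set
Measure n = List (ℚ × Subset n)

mass : ∀ {n} → Measure n → ℚ
mass μ = ∑ μ proj₁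

cover : ∀ {n} → Fin n → Measure n → ℚ
cover v μ = ∑ μ (λ (a , I) → a when lookup I v)

module _ {n : ℕ} (κ : ℚ) (v : Fin n) where

  kept : Subset n → ℚ
  kept I = if lookup I v then κ else 1ℚ

  -- An atom whose set contains `v` keeps the fraction `κ` of its mass and passes the rest to the
  -- set without `v`. Any other atom keeps all its mass, and its second piece has mass zero.
  trimSet : ℚ × Subset n → Measure n
  trimSet (a , I) = (kept I * a , I) ∷ ((1ℚ - kept I) * a , I [ v ]≔ outside) ∷ []

  trim : Measure n → Measure n
  trim = concatMap trimSet

  mass-trim : ∀ μ → mass (trim μ) ≡ mass μ
  mass-trim μ = trans (∑-concatMap trimSet μ) (∑-cong μ λ { {a , I} _ →
    solve 2 (λ k a → k :* a :+ ((con 1ℚ :- k) :* a :+ con 0ℚ) := a) refl (kept I) a })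
    where open +-*-Solver

  cover-trim-other : ∀ {u} → u ≢ v → ∀ μ → cover u (trim μ) ≡ cover u μ
  cover-trim-other {u} u≢v μ = trans (∑-concatMap trimSet μ) (∑-cong μ λ { {a , I} _ → step a I })
    where
    open +-*-Solver
    step : ∀ a I → ∑ (trimSet (a , I)) (λ (a , I) → a when lookup I u) ≡ (a when lookup I u)
    step a I rewrite Vec.lookup∘update′ u≢v I outside with lookup I u
    ... | true  = solve 2 (λ k a → k :* a :+ ((con 1ℚ :- k) :* a :+ con 0ℚ) := a) refl (kept I) a
    ... | false = refl

  cover-trim : ∀ μ → cover v (trim μ) ≡ κ * cover v μ
  cover-trim μ = trans (∑-concatMap trimSet μ) (trans (∑-cong μ λ { {a , I} _ → step a I }) (∑-* κ μ))
    where
    step : ∀ a I → ∑ (trimSet (a , I)) (λ (a , I) → a when lookup I v) ≡ κ * (a when lookup I v)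
    step a I rewrite Vec.lookup∘update v I outside with lookup I v
    ... | true  = +-identityʳ (κ * a)
    ... | false = sym (*-zeroʳ κ)

*-nonneg : ∀ {x y} → 0ℚ ≤ x → 0ℚ ≤ y → 0ℚ ≤ x * y
*-nonneg {x} {y} 0≤x 0≤y = ≤-trans (≤-reflexive (sym (*-zeroʳ x)))
  (*-monoˡ-≤-nonNeg x {{nonNegative 0≤x}} 0≤y)

module _ {n : ℕ} (G : SimpleGraph n) where

  Supported : Measure n → Set
  Supported = All (λ (a , I) → 0ℚ ≤ a × Independent G I)

  independent-remove : ∀ {I} v → Independent G I → Independent G (I [ v ]≔ outside)
  independent-remove {I} v ind x y x∈ y∈ = ind x y (⊆I x∈) (⊆I y∈)
    where
    ⊆I : ∀ {x} → x ∈ₛ (I [ v ]≔ outside) → x ∈ₛ I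
    ⊆I {x} x∈ with x Fin.≟ v
    ... | yes refl = contradiction (trans (sym (Vec.[]=⇒lookup x∈)) (Vec.lookup∘update x I outside)) λ ()
    ... | no x≢v   = Vec.lookup⇒[]= x I (trans (sym (Vec.lookup∘update′ x≢v I outside)) (Vec.[]=⇒lookup x∈))

  trim-supported : ∀ {κ} v → 0ℚ ≤ κ → κ ≤ 1ℚ → ∀ {μ} → Supported μ → Supported (trim κ v μ)
  trim-supported v 0≤κ κ≤1 [] = []
  trim-supported {κ} v 0≤κ κ≤1 {(a , I) ∷ μ} ((0≤a , ind) ∷ sup) =
    (*-nonneg (proj₁ bounds) 0≤a , ind) ∷
    (*-nonneg (proj₂ bounds) 0≤a , independent-remove v ind) ∷
    trim-supported v 0≤κ κ≤1 sup
    where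
    bounds : 0ℚ ≤ kept κ v I × 0ℚ ≤ 1ℚ - kept κ v I
    bounds with lookup I v
    ... | true  = 0≤κ , p≤q⇒0≤q-p κ≤1
    ... | false = nonNegative⁻¹ 1ℚ , ≤-refl

  -- Vertices are treated one at a time. Trimming at `v` by the inverse of its coverage makes that
  -- coverage exactly 1 and leaves the coverage of other vertices alone, so earlier work is not
  -- undone. Coverage at least 1 is carried along because it gives `κ ≤ 1ℚ`.
  saturate : ∀ vs {μ} → Supported μ → (∀ v → 1ℚ ≤ cover v μ) → ∃[ μ′ ]
             Supported μ′ × (∀ v → 1ℚ ≤ cover v μ′) ×
             (∀ v → v ∈ vs → cover v μ′ ≡ 1ℚ) × mass μ′ ≡ mass μ
  saturate [] {μ} sup cov = μ , sup , cov , (λ _ ()) , refl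
  saturate (v ∷ vs) sup cov with saturate vs sup cov
  ... | μ , sup′ , cov′ , exact , mass≡ =
    trim κ v μ , trim-supported v (<⇒≤ 0<κ) κ≤1 sup′ , cov″ , exact″ ,
    trans (mass-trim κ v μ) mass≡
    where
    c = cover v μ
    0<c : 0ℚ < c
    0<c = <-≤-trans (positive⁻¹ 1ℚ) (cov′ v)
    κ = proj₁ (positive-inverse 0<c)
    0<κ = proj₁ (proj₂ (positive-inverse 0<c))
    κc≡1 = proj₂ (proj₂ (positive-inverse 0<c))
    κ≤1 : κ ≤ 1ℚ
    κ≤1 = begin
      κ        ≡⟨ *-identityʳ κ ⟨
      κ * 1ℚ   ≤⟨ *-monoˡ-≤-nonNeg κ {{nonNegative (<⇒≤ 0<κ)}} (cov′ v) ⟩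
      κ * c    ≡⟨ κc≡1 ⟩
      1ℚ       ∎
      where open ≤-Reasoning
    at-v : cover v (trim κ v μ) ≡ 1ℚ
    at-v = trans (cover-trim κ v μ) κc≡1
    cov″ : ∀ u → 1ℚ ≤ cover u (trim κ v μ)
    cov″ u with u Fin.≟ v
    ... | yes refl = ≤-reflexive (sym at-v)
    ... | no u≢v   = ≤-trans (cov′ u) (≤-reflexive (sym (cover-trim-other κ v u≢v μ)))
    exact″ : ∀ u → u ∈ v ∷ vs → cover u (trim κ v μ) ≡ 1ℚ
    exact″ u u∈ with u Fin.≟ v | u∈
    ... | yes refl | _         = at-v
    ... | no u≢v   | here u≡v  = contradiction u≡v u≢v
    ... | no u≢v   | there u∈′ = trans (cover-trim-other κ v u≢v μ) (exact u u∈′)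

  -- A random independent set containing each vertex with probability one third: an exact fractional
  -- colouring of weight 3, divided by 3.
  record UniformColouring : Set where
    field
      weight        : Subset n → ℚ
      weight-nonneg : ∀ I → 0ℚ ≤ weight I
      total         : ∑ (independentSets G) weight ≡ 1ℚ
      marginal      : ∀ v → ∑ (independentSets G) (λ I → weight I when lookup I v) ≡ ⅓

  normalise : ∀ {μ} → Supported μ → (∀ v → cover v μ ≡ 1ℚ) → mass μ ≡ 3ℚ → UniformColouring
  normalise {μ} sup cov mass≡3 = record
    { weight        = push
    ; weight-nonneg = push-nonneg λ x∈ → *-nonneg (nonNegative⁻¹ ⅓) (proj₁ (All.lookup sup x∈))
    ; total         = trans (∑-push (independentSets G) represented (λ _ → true) (λ _ → true) (λ _ _ _ → refl))
                        (trans (∑-* ⅓ μ) (cong (⅓ *_) mass≡3))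
    ; marginal      = λ v → trans
        (∑-push (independentSets G) represented (λ J → lookup J v) (λ (_ , I) → lookup I v) (λ { _ _ refl → refl }))
        (trans (∑-cong μ λ { {a , I} _ → scaled a (lookup I v) }) (trans (∑-* ⅓ μ) (cong (⅓ *_) (cov v))))
    }
    where
    open Push (λ (x : ℚ × Subset n) J → proj₂ x ≟ᶜ J) μ (λ (a , _) → ⅓ * a)
    represented : ∀ {x} → x ∈ μ → ∑ (independentSets G) (λ J → ⅓ * proj₁ x when does (proj₂ x ≟ᶜ J)) ≡ ⅓ * proj₁ x
    represented {a , I} x∈ = ∑-≡ (⅓ * a) I (independentSets-unique G)
      (∈-independentSets G (proj₂ (All.lookup sup x∈)))
    scaled : ∀ a b → (⅓ * a when b) ≡ ⅓ * (a when b)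
    scaled a true  = refl
    scaled a false = refl

  uniform-colouring : ∀ {w} → IsFractionalColouring G w → ∑ (independentSets G) w ≤ 3ℚ → UniformColouring
  uniform-colouring {w} (w≥0 , cov) ≤3 =
    let μ , sup , _ , exact , mass≡ = saturate (allFin n) {μ₀} supported covered
    in  normalise sup (λ v → exact v (∈-allFin v)) (trans mass≡ mass≡3)
    where
    slack = 3ℚ - ∑ (independentSets G) w
    weigh = λ I → w I , I
    μ₀ : Measure n
    -- Placing the missing mass on the empty set brings the total to exactly 3 without changing any
    -- coverage.
    μ₀ = (slack , ∅) ∷ map weigh (independentSets G)
    supported : Supported μ₀
    supported = (p≤q⇒0≤q-p ≤3 , λ _ _ u∈ _ → contradiction u∈ ∉⊥) ∷
      All.map⁺ (All.tabulate λ {I} I∈ → w≥0 I , independentSets-independent G I∈)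
    mass≡3 : mass μ₀ ≡ 3ℚ
    mass≡3 = trans (cong (_+_ slack) (∑-map weigh (independentSets G)))
      (solve 2 (λ x s → x :- s :+ s := x) refl 3ℚ (∑ (independentSets G) w))
      where open +-*-Solver
    covered : ∀ v → 1ℚ ≤ cover v μ₀
    covered v = ≤-trans (cov v) (≤-reflexive (trans (coverage G v w) (sym (trans
      (cong₂ _+_ (cong (slack when_) (Vec.lookup-replicate v outside)) (∑-map weigh (independentSets G)))
      (+-identityˡ _)))))

-- Two-colourings of the anchor hypergraph

deduplicate-pairs : ∀ {A : Set} {R : Rel A 0ℓ} (R? : Binary.Decidable R) xs →
                    AllPairs (λ x y → ¬ R x y) (deduplicate R? xs)
deduplicate-pairs R? []       = []
deduplicate-pairs R? (x ∷ xs) =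
  All.all-filter (¬? ∘ R? x) (deduplicate R? xs) ∷ AllPairs.filter⁺ (¬? ∘ R? x) (deduplicate-pairs R? xs)

0-when : ∀ b → (0ℚ when b) ≡ 0ℚ
0-when true  = refl
0-when false = refl

when-split : ∀ x b → x ≡ (x when b) + (x when not b)
when-split x true  = sym (+-identityʳ x)
when-split x false = sym (+-identityˡ x)

-- The arbitrary conclusion `X` lets this close the impossible branch of a case analysis, where both
-- ends of an edge lie in the set.
lookup-independent : ∀ {n} (G : SimpleGraph n) {I} → Independent G I →
  ∀ {u v} → SimpleGraph.Adj G u v → lookup I u ≡ true → lookup I v ≡ true → ∀ {X : Set} → X
lookup-independent G {I} ind {u} {v} uv u∈ v∈ =
  contradiction uv (ind u v (Vec.lookup⇒[]= u I u∈) (Vec.lookup⇒[]= v I v∈))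

-- Both ends of an edge never occur together, so exactly one given end, or neither, occurs: the
-- first two cases have probability one third each, which leaves one third for the last. The
-- arbitrary test `F` serves both minority positions and entries of the NAE table.
joint-marginal : ∀ {n} {G : SimpleGraph n} (C : UniformColouring G) →
  ∀ {u v} → SimpleGraph.Adj G u v → (F : Bool → Bool → Bool) →
  ∑ (independentSets G) (λ I → UniformColouring.weight C I when F (lookup I u) (lookup I v)) ≡
  (⅓ when F true false) + (⅓ when F false true) + (⅓ when F false false)
joint-marginal {n} {G} C {u} {v} uv F = begin
  ∑ Is (λ I → weight I when F (lookup I u) (lookup I v))
    ≡⟨ ∑-cong Is decompose ⟩
  ∑ Is (λ I → (weight I when lookup I u when F true false)
            + (weight I when lookup I v when F false true)
            + (weight I when neither I when F false false))
    ≡⟨ trans (∑-+ Is) (cong (_+ ∑ Is (λ I → weight I when neither I when F false false)) (∑-+ Is)) ⟩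
  ∑ Is (λ I → weight I when lookup I u when F true false)
    + ∑ Is (λ I → weight I when lookup I v when F false true)
    + ∑ Is (λ I → weight I when neither I when F false false)
    ≡⟨ cong₂ _+_ (cong₂ _+_ (part (F true false) (marginal u)) (part (F false true) (marginal v)))
                 (part (F false false) neither-marginal) ⟩
  (⅓ when F true false) + (⅓ when F false true) + (⅓ when F false false) ∎
  where
  open ≡-Reasoning
  open UniformColouring C
  Is = independentSets G
  neither : Subset n → Bool
  neither I = not (lookup I u) ∧ not (lookup I v)
  part : ∀ {f x} b → ∑ Is f ≡ x → ∑ Is (λ I → f I when b) ≡ (x when b)
  part b eq = trans (∑-when b Is) (cong (_when b) eq)

  decompose : ∀ {I} → I ∈ Is → (weight I when F (lookup I u) (lookup I v)) ≡
    (weight I when lookup I u when F true false)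
      + (weight I when lookup I v when F false true)
      + (weight I when neither I when F false false)
  decompose {I} I∈ with lookup I u in u∈ | lookup I v in v∈
  ... | true  | true  = lookup-independent G (independentSets-independent G I∈) uv u∈ v∈
  ... | true  | false rewrite 0-when (F false true) | 0-when (F false false) =
    sym (trans (+-identityʳ _) (+-identityʳ _))
  ... | false | true  rewrite 0-when (F true false) | 0-when (F false false) =
    sym (trans (+-identityʳ _) (+-identityˡ _))
  ... | false | false rewrite 0-when (F true false) | 0-when (F false true) =
    sym (+-identityˡ _)

  trichotomy : ∀ {I} → I ∈ Is →
    weight I ≡ (weight I when lookup I u) + (weight I when lookup I v) + (weight I when neither I)
  trichotomy {I} I∈ with lookup I u in u∈ | lookup I v in v∈
  ... | true  | true  = lookup-independent G (independentSets-independent G I∈) uv u∈ v∈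
  ... | true  | false = sym (trans (+-identityʳ _) (+-identityʳ _))
  ... | false | true  = sym (trans (+-identityʳ _) (+-identityˡ _))
  ... | false | false = sym (+-identityˡ _)

  N = ∑ Is (λ I → weight I when neither I)
  neither-marginal : N ≡ ⅓
  neither-marginal = begin
    N                     ≡⟨ solve 2 (λ t N → N := t :+ t :+ N :- t :- t) refl ⅓ N ⟩
    ⅓ + ⅓ + N - ⅓ - ⅓     ≡⟨ cong (λ x → x - ⅓ - ⅓) sums ⟨
    1ℚ - ⅓ - ⅓            ≡⟨⟩
    ⅓                     ∎
    where
    open +-*-Solver
    sums : 1ℚ ≡ ⅓ + ⅓ + N
    sums = begin
      1ℚ                   ≡⟨ total ⟨
      ∑ Is weight          ≡⟨ ∑-cong Is trichotomy ⟩
      ∑ Is (λ I → (weight I when lookup I u) + (weight I when lookup I v) + (weight I when neither I))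
        ≡⟨ trans (∑-+ Is) (cong (_+ N) (∑-+ Is)) ⟩
      ∑ Is (λ I → weight I when lookup I u) + ∑ Is (λ I → weight I when lookup I v) + N
        ≡⟨ cong (_+ N) (cong₂ _+_ (marginal u) (marginal v)) ⟩
      ⅓ + ⅓ + N ∎

-- The set of vertices of G that share the colour of the anchor.
side : ∀ {n} → Colouring (suc n) → Subset n
side (s ∷ xs) = Vec.map (λ b → does (b Bool.≟ s)) xs

-- Inverse of `side` for a given anchor colour `s`. Comparison with `s` is an involution on colours,
-- so the same map encodes and decodes.
colouringOf : ∀ {n} → Bool → Subset n → Colouring (suc n)
colouringOf s I = s ∷ Vec.map (λ b → does (b Bool.≟ s)) I

same-involutive : ∀ s b → does (does (b Bool.≟ s) Bool.≟ s) ≡ b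
same-involutive false false = refl
same-involutive false true  = refl
same-involutive true  false = refl
same-involutive true  true  = refl

map-same-involutive : ∀ {n} s (xs : Vec Bool n) →
  Vec.map (λ b → does (b Bool.≟ s)) (Vec.map (λ b → does (b Bool.≟ s)) xs) ≡ xs
map-same-involutive s []       = refl
map-same-involutive s (x ∷ xs) = cong₂ _∷_ (same-involutive s x) (map-same-involutive s xs)

side-colouringOf : ∀ {n} s (I : Subset n) → side (colouringOf s I) ≡ I
side-colouringOf = map-same-involutive

colouringOf-side : ∀ {n} s (xs : Vec Bool n) → colouringOf s (side (s ∷ xs)) ≡ s ∷ xs
colouringOf-side s xs = cong (s ∷_) (map-same-involutive s xs)

colouringOf-not : ∀ {n} s (I : Subset n) → colouringOf (not s) I ≡ Vec.map not (colouringOf s I)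
colouringOf-not s I = cong (not s ∷_) (go s I)
  where
  go : ∀ {n} s (I : Subset n) →
    Vec.map (λ b → does (b Bool.≟ not s)) I ≡ Vec.map not (Vec.map (λ b → does (b Bool.≟ s)) I)
  go s     []          = refl
  go false (false ∷ I) = cong (_ ∷_) (go false I)
  go false (true ∷ I)  = cong (_ ∷_) (go false I)
  go true  (false ∷ I) = cong (_ ∷_) (go true I)
  go true  (true ∷ I)  = cong (_ ∷_) (go true I)

-- With equal anchor colours both colourings are decoded from the same set; with opposite ones they
-- are complementary. Together with `side-cong` this identifies complement classes with subsets.
side-injective : ∀ {n} (S T : Colouring (suc n)) → side S ≡ side T → S ~ T
side-injective (s ∷ xs) (t ∷ ys) eq with s Bool.≟ t
... | yes refl = inj₁ (trans (sym (colouringOf-side s xs)) (trans (cong (colouringOf s) eq) (colouringOf-side s ys)))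
... | no s≢t with Bool.¬-not s≢t
... | refl = inj₂ (trans (sym (colouringOf-side (not t) xs)) (trans (cong (colouringOf (not t)) eq)
  (trans (colouringOf-not t (side (t ∷ ys))) (cong (Vec.map not) (colouringOf-side t ys)))))

side-complement : ∀ {n} (S : Colouring (suc n)) → side (Vec.map not S) ≡ side S
side-complement (s ∷ xs) = begin
  side (Vec.map not (s ∷ xs))                            ≡⟨ cong (side ∘ Vec.map not) (colouringOf-side s xs) ⟨
  side (Vec.map not (colouringOf s (side (s ∷ xs))))     ≡⟨ cong side (colouringOf-not s (side (s ∷ xs))) ⟨
  side (colouringOf (not s) (side (s ∷ xs)))             ≡⟨ side-colouringOf (not s) _ ⟩
  side (s ∷ xs)                                          ∎
  where open ≡-Reasoning

side-cong : ∀ {n} {S T : Colouring (suc n)} → S ~ T → side S ≡ side T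
side-cong (inj₁ refl) = refl
side-cong {T = T} (inj₂ refl) = side-complement T

lookup-side : ∀ {n} s (xs : Vec Bool n) v → lookup (side (s ∷ xs)) v ≡ does (lookup xs v Bool.≟ s)
lookup-side s xs v = Vec.lookup-map v (λ b → does (b Bool.≟ s)) xs

-- minorityPattern j p q decides m_e = j when p and q tell whether the second
-- and third vertex of e have the colour of the first.
minorityPattern : Fin 3 → Bool → Bool → Bool
minorityPattern zero             p q = not p ∧ not q
minorityPattern (suc zero)       p q = not p ∧ q
minorityPattern (suc (suc zero)) p q = p ∧ not q

-- Decided by evaluation over the eight colourings of a single hyperedge.
minority-table : ∀ j → All (λ S → does (minority? (zero ∷ suc zero ∷ suc (suc zero) ∷ []) j S) ≡
                             minorityPattern j (lookup (side S) zero) (lookup (side S) (suc zero)))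
                           (boolVecs 3)
minority-table = from-yes (Fin.all? λ j → all? (λ S →
  does (minority? (zero ∷ suc zero ∷ suc (suc zero) ∷ []) j S) Bool.≟
  minorityPattern j (lookup (side S) zero) (lookup (side S) (suc zero))) (boolVecs 3))

module _ {n : ℕ} {G : SimpleGraph n} (O : Orientation G) where
  open SimpleGraph G using (Adj)
  open Orientation O

  does-minority : ∀ j u v (S : Colouring (suc n)) →
    does (minority? (anchorEdge O (u , v)) j S) ≡
    minorityPattern j (lookup (side S) u) (lookup (side S) v)
  does-minority j u v (s ∷ xs) rewrite lookup-side s xs u | lookup-side s xs v =
    trans (relabel j) (All.lookup (minority-table j) (∈-boolVecs (s ∷ lookup xs u ∷ lookup xs v ∷ [])))
    where
    -- A minority position depends only on the three colours on the hyperedge, so the colouring may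
    -- be restricted to three vertices; for each concrete `j` both decisions compute alike.
    relabel : ∀ j → does (minority? (anchorEdge O (u , v)) j (s ∷ xs)) ≡
                    does (minority? (zero ∷ suc zero ∷ suc (suc zero) ∷ []) j (s ∷ lookup xs u ∷ lookup xs v ∷ []))
    relabel zero             = refl
    relabel (suc zero)       = refl
    relabel (suc (suc zero)) = refl

-- Minority positions

⅔ : ℚ
⅔ = + 2 / 3

-- The bound on the fractional chromatic number stated through a witness instead of a minimum; both
-- equivalences pass through it.
SmallColouring : ∀ {n} → SimpleGraph n → Set
SmallColouring G = ∃[ w ] IsFractionalColouring G w × ∑ (independentSets G) w ≤ 3ℚ

-- A random independent set that misses each vertex with probability at most two thirds becomes,
-- scaled by 3, a fractional colouring of weight 3. It is applied to colouring classes and to global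
-- assignments; the latter yield independent sets only on the support of the weight, hence the
-- condition `f x ≢ 0ℚ`.
small-colouring : ∀ {n} (G : SimpleGraph n) {A : Set} (xs : List A) (f : A → ℚ) (σ : A → Subset n) →
  (∀ x → 0ℚ ≤ f x) → (∀ {x} → x ∈ xs → f x ≢ 0ℚ → Independent G (σ x)) →
  ∑ xs f ≡ 1ℚ → (∀ v → ∑ xs (λ x → f x when not (lookup (σ x) v)) ≤ ⅔) →
  SmallColouring G
small-colouring {n} G xs f σ f≥0 ind total missed =
  w , ((λ I → *-nonneg (nonNegative⁻¹ 3ℚ) (push-nonneg (λ {x} _ → f≥0 x) I)) , covered) ,
  ≤-reflexive (trans (∑-* 3ℚ Is) (cong (3ℚ *_) (trans
    (∑-push Is represented (λ _ → true) (λ _ → true) (λ _ _ _ → refl)) total)))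
  where
  Is = independentSets G
  open Push (λ x I → σ x ≟ᶜ I) xs f
  w : Subset n → ℚ
  w I = 3ℚ * push I
  represented : ∀ {x} → x ∈ xs → ∑ Is (λ I → f x when does (σ x ≟ᶜ I)) ≡ f x
  represented {x} x∈ with f x ≟ 0ℚ
  -- An entry of weight zero may have a set that is not independent; both sides then vanish.
  ... | yes f≡0 = trans (∑-cong Is λ {I} _ → cong (_when does (σ x ≟ᶜ I)) f≡0)
    (trans (∑-cong Is λ {I} _ → 0-when (does (σ x ≟ᶜ I))) (trans (∑-0 Is) (sym f≡0)))
  ... | no f≢0  = ∑-≡ (f x) (σ x) (independentSets-unique G) (∈-independentSets G (ind x∈ f≢0))
  covered : ∀ v → 1ℚ ≤ ∑ (filter (v ∈?_) Is) w
  covered v = begin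
    1ℚ                       ≡⟨⟩
    3ℚ * (1ℚ - ⅔)            ≤⟨ *-monoˡ-≤-nonNeg 3ℚ (+-monoʳ-≤ 1ℚ (neg-antimono-≤ (missed v))) ⟩
    3ℚ * (1ℚ - M)            ≡⟨ cong (λ t → 3ℚ * (t - M)) (trans (sym total)
                                  (trans (∑-cong xs λ {x} _ → when-split (f x) (lookup (σ x) v)) (∑-+ xs))) ⟩
    3ℚ * (K + M - M)         ≡⟨ cong (3ℚ *_) (solve 2 (λ k m → k :+ m :- m := k) refl K M) ⟩
    3ℚ * K                   ≡⟨ cong (3ℚ *_) (∑-push Is represented (λ I → lookup I v) (λ x → lookup (σ x) v)
                                  (λ { _ _ refl → refl })) ⟨
    3ℚ * ∑ Is (λ I → push I when lookup I v)  ≡⟨ ∑-* 3ℚ Is ⟨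
    ∑ Is (λ I → 3ℚ * (push I when lookup I v)) ≡⟨ ∑-cong Is (λ {I} _ → scaled I (lookup I v)) ⟩
    ∑ Is (λ I → w I when lookup I v)          ≡⟨ coverage G v w ⟨
    ∑ (filter (v ∈?_) Is) w  ∎
    where
    open ≤-Reasoning
    open +-*-Solver
    K = ∑ xs (λ x → f x when lookup (σ x) v)
    M = ∑ xs (λ x → f x when not (lookup (σ x) v))
    scaled : ∀ I b → 3ℚ * (push I when b) ≡ (w I when b)
    scaled I true  = refl
    scaled I false = refl

same⇒≡ : ∀ {a b} → does (a Bool.≟ b) ≡ true → a ≡ b
same⇒≡ {a} {b} eq with a Bool.≟ b
... | yes a≡b = a≡b
same⇒≡ () | no _

module _ {n : ℕ} {G : SimpleGraph n} (O : Orientation G) where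
  open SimpleGraph G using (Adj)
  open Orientation O

  private
    H : Hypergraph₃ (suc n)
    H = anchor O

    Is = independentSets G

  arc? : ∀ ((u , v) : Fin n × Fin n) → Dec (u ⟶ v)
  arc? (u , v) = u ⟶? v

  arc⇒hyperedge : ∀ {u v} → u ⟶ v → anchorEdge O (u , v) ∈ Hypergraph₃.hyperedges H
  arc⇒hyperedge {u} {v} uv =
    ∈-map⁺ (anchorEdge O) (∈-filter⁺ arc? (∈-cartesianProduct⁺ (∈-allFin u) (∈-allFin v)) uv)

  hyperedge⇒arc : ∀ {e} → e ∈ Hypergraph₃.hyperedges H → ∃[ u ] ∃[ v ] u ⟶ v × e ≡ anchorEdge O (u , v)
  hyperedge⇒arc e∈ with ∈-map⁻ (anchorEdge O) e∈
  ... | (u , v) , uv∈ , e≡ =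
    u , v , proj₂ (∈-filter⁻ arc? {xs = cartesianProduct (allFin n) (allFin n)} uv∈) , e≡

  arcs⇒independent : ∀ {I} → (∀ {u v} → u ⟶ v → lookup I u ≡ true → lookup I v ≡ true → ⊥) → Independent G I
  arcs⇒independent noArc u v u∈ v∈ uv with covers uv
  ... | inj₁ u⟶v = noArc u⟶v (Vec.[]=⇒lookup u∈) (Vec.[]=⇒lookup v∈)
  ... | inj₂ v⟶u = noArc v⟶u (Vec.[]=⇒lookup v∈) (Vec.[]=⇒lookup u∈)

  proper⇒independent : ∀ S → Proper H S → Independent G (side S)
  proper⇒independent (s ∷ xs) proper = arcs⇒independent λ {u} {v} u⟶v u∈ v∈ →
    let eq : ∀ i → colour (s ∷ xs) (anchorEdge O (u , v)) i ≡ s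
        eq = λ { zero             → refl
               ; (suc zero)       → same⇒≡ (trans (sym (lookup-side s xs u)) u∈)
               ; (suc (suc zero)) → same⇒≡ (trans (sym (lookup-side s xs v)) v∈) }
    in  All.lookup proper (arc⇒hyperedge u⟶v) (λ i j → trans (eq i) (sym (eq j)))

  independent⇒proper : ∀ S → Independent G (side S) → Proper H S
  independent⇒proper (s ∷ xs) ind = All.tabulate λ e∈ constant → case (hyperedge⇒arc e∈) constant
    where
    case : ∀ {e} → ∃[ u ] ∃[ v ] u ⟶ v × e ≡ anchorEdge O (u , v) → ¬ ConstantOn (s ∷ xs) e
    case (u , v , u⟶v , refl) constant = lookup-independent G ind (sound u⟶v)
      (trans (lookup-side s xs u) (dec-true (lookup xs u Bool.≟ s) (constant (suc zero) zero)))
      (trans (lookup-side s xs v) (dec-true (lookup xs v Bool.≟ s) (constant (suc (suc zero)) zero)))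

  classes-proper : ∀ {S} → S ∈ classes H → Proper H S
  classes-proper S∈ = proj₂ (∈-filter⁻ (proper? H) {xs = boolVecs (suc n)} (∈-deduplicate⁻ _~?_ _ S∈))

  -- Exactly one listed class has side `I`: two of them would be related by `side-injective`, and
  -- `colouringOf false I` provides one.
  ∑-classes : ∀ c {I} → Independent G I → ∑ (classes H) (λ S → c when does (I ≟ᶜ side S)) ≡ c
  ∑-classes c {I} ind = ∑-select (λ S → I ≟ᶜ side S) c (classes H)
    (AllPairs.map (λ {S} {T} S≁T I≡S I≡T → S≁T (side-injective S T (trans (sym I≡S) I≡T)))
      (deduplicate-pairs _~?_ (filter (proper? H) (boolVecs (suc n)))))
    -- Deduplication may retain the complement of this colouring instead, which has the same side.
    (Any.deduplicate⁺ _~?_ (λ T~S I≡S → trans I≡S (sym (side-cong T~S)))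
      (Any.map (λ { {S} refl → sym (side-colouringOf false I) })
        (∈-filter⁺ (proper? H) (∈-boolVecs (colouringOf false I))
          (independent⇒proper (colouringOf false I) (subst (Independent G) (sym (side-colouringOf false I)) ind)))))

  Pr-pattern : ∀ q j u v → Pr[_,_↦_] H q (anchorEdge O (u , v)) j ≡
    ∑ (classes H) (λ S → q S when minorityPattern j (lookup (side S) u) (lookup (side S) v))
  Pr-pattern q j u v = trans (∑-filter (minority? (anchorEdge O (u , v)) j) (classes H))
    (∑-cong (classes H) λ {S} _ → cong (q S when_) (does-minority O j u v S))

  module _ {q : Colouring (suc n) → ℚ} (q≥0 : ∀ S → 0ℚ ≤ q S) {u v : Fin n} where
    private
      Pr : Fin 3 → ℚ
      Pr = Pr[_,_↦_] H q (anchorEdge O (u , v))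

      p₀ p₁ p₂ : Colouring (suc n) → ℚ
      p₀ S = q S when minorityPattern zero (lookup (side S) u) (lookup (side S) v)
      p₁ S = q S when minorityPattern (suc zero) (lookup (side S) u) (lookup (side S) v)
      p₂ S = q S when minorityPattern (suc (suc zero)) (lookup (side S) u) (lookup (side S) v)

      sum₂ : ∀ {j k} → ∑ (classes H) (λ S →
                (q S when minorityPattern j (lookup (side S) u) (lookup (side S) v)) +
                (q S when minorityPattern k (lookup (side S) u) (lookup (side S) v))) ≡ Pr j + Pr k
      sum₂ {j} {k} = trans (∑-+ (classes H)) (sym (cong₂ _+_ (Pr-pattern q j u v) (Pr-pattern q k u v)))

    -- If `u` is missed, the minority is the anchor when `v` is missed too, and `u` otherwise.
    tail-missed : ∑ (classes H) (λ S → q S when not (lookup (side S) u)) ≤ Pr zero + Pr (suc zero)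
    tail-missed = ≤-trans (∑-mono (classes H) λ {S} _ → pointwise S) (≤-reflexive sum₂)
      where
      pointwise : ∀ S → (q S when not (lookup (side S) u)) ≤ p₀ S + p₁ S
      pointwise S with lookup (side S) u | lookup (side S) v
      ... | true  | _     = ≤-refl
      ... | false | true  = ≤-reflexive (sym (+-identityˡ (q S)))
      ... | false | false = ≤-reflexive (sym (+-identityʳ (q S)))

    head-missed : ∑ (classes H) (λ S → q S when not (lookup (side S) v)) ≤ Pr zero + Pr (suc (suc zero))
    head-missed = ≤-trans (∑-mono (classes H) λ {S} _ → pointwise S) (≤-reflexive sum₂)
      where
      pointwise : ∀ S → (q S when not (lookup (side S) v)) ≤ p₀ S + p₂ S
      pointwise S with lookup (side S) u | lookup (side S) v
      ... | false | true  = ≤-refl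
      ... | true  | true  = ≤-refl
      ... | true  | false = ≤-reflexive (sym (+-identityˡ (q S)))
      ... | false | false = ≤-reflexive (sym (+-identityʳ (q S)))

    total-minority : u ⟶ v → ∑ (classes H) q ≤ Pr zero + Pr (suc zero) + Pr (suc (suc zero))
    total-minority u⟶v = ≤-trans (∑-mono (classes H) λ {S} → pointwise S)
      (≤-reflexive (trans (∑-+ (classes H)) (cong₂ _+_ sum₂ (sym (Pr-pattern q (suc (suc zero)) u v)))))
      where
      pointwise : ∀ S → S ∈ classes H → q S ≤ p₀ S + p₁ S + p₂ S
      pointwise S S∈ with lookup (side S) u in u∈ | lookup (side S) v in v∈
      ... | true  | true  = lookup-independent G (proper⇒independent S (classes-proper S∈)) (sound u⟶v) u∈ v∈
      ... | true  | false = ≤-reflexive (sym (+-identityˡ (q S)))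
      ... | false | true  = ≤-reflexive (sym (trans (+-identityʳ _) (+-identityˡ (q S))))
      ... | false | false = ≤-reflexive (sym (trans (+-identityʳ _) (+-identityʳ (q S))))

  -- Every vertex lies on some arc, and being missed forces the minority on that arc to be the
  -- anchor or the vertex itself, which costs at most one third each.
  beta⇒small-colouring : NoIsolatedVertices G → IsBeta H ⅓ → SmallColouring G
  beta⇒small-colouring noIso ((q , (q≥0 , total) , _ , max) , _) =
    small-colouring G (classes H) q side q≥0
      (λ {S} S∈ _ → proper⇒independent S (classes-proper S∈)) total missed
    where
    ≤⅓ : ∀ {u v} → u ⟶ v → ∀ j → Pr[_,_↦_] H q (anchorEdge O (u , v)) j ≤ ⅓
    ≤⅓ u⟶v j = max _ (_ , j , arc⇒hyperedge u⟶v , refl)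
    missed : ∀ v → ∑ (classes H) (λ S → q S when not (lookup (side S) v)) ≤ ⅔
    missed v with noIso v
    ... | x , vx with covers vx
    ... | inj₁ v⟶x = ≤-trans (tail-missed q≥0) (+-mono-≤ (≤⅓ v⟶x zero) (≤⅓ v⟶x (suc zero)))
    ... | inj₂ x⟶v = ≤-trans (head-missed q≥0) (+-mono-≤ (≤⅓ x⟶v zero) (≤⅓ x⟶v (suc (suc zero))))

  -- On any hyperedge the three minority probabilities sum to at least 1, so their maximum is at
  -- least one third.
  beta≥⅓ : ∀ {u v} → u ⟶ v → ∀ y → ∃[ q ] IsDistribution H q × IsMaxMinorityProbability H q y → ⅓ ≤ y
  beta≥⅓ {u} {v} u⟶v y (q , (q≥0 , total) , _ , max) = *-cancelˡ-≤-pos 3ℚ (begin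
    3ℚ * ⅓                                        ≡⟨⟩
    1ℚ                                            ≡⟨ total ⟨
    ∑ (classes H) q                               ≤⟨ total-minority q≥0 u⟶v ⟩
    Pr zero + Pr (suc zero) + Pr (suc (suc zero))
      ≤⟨ +-mono-≤ (+-mono-≤ (≤y zero) (≤y (suc zero))) (≤y (suc (suc zero))) ⟩
    y + y + y                                     ≡⟨ solve 1 (λ y → y :+ y :+ y := con 3ℚ :* y) refl y ⟩
    3ℚ * y                                        ∎)
    where
    open ≤-Reasoning
    open +-*-Solver
    Pr : Fin 3 → ℚ
    Pr = Pr[_,_↦_] H q (anchorEdge O (u , v))
    ≤y : ∀ j → Pr j ≤ y
    ≤y j = max _ (_ , j , arc⇒hyperedge u⟶v , refl)

  uniform-colouring⇒beta : HasEdge G → UniformColouring G → IsBeta H ⅓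
  uniform-colouring⇒beta (x , y , xy) C =
    (q , (q≥0 , trans (∑-push (classes H) represented (λ _ → true) (λ _ → true) (λ _ _ _ → refl)) total) ,
      attained anArc , λ { z (e , j , e∈ , refl) → bounded j (hyperedge⇒arc e∈) }) ,
    beta≥⅓ (proj₂ (proj₂ anArc))
    where
    open UniformColouring C
    open Push (λ I S → I ≟ᶜ side S) Is weight renaming (push to q)
    q≥0 = push-nonneg λ {I} _ → weight-nonneg I
    represented : ∀ {I} → I ∈ Is → ∑ (classes H) (λ S → weight I when does (I ≟ᶜ side S)) ≡ weight I
    represented {I} I∈ = ∑-classes (weight I) (independentSets-independent G I∈)
    anArc : ∃[ u ] ∃[ v ] u ⟶ v
    anArc with covers xy
    ... | inj₁ x⟶y = x , y , x⟶y
    ... | inj₂ y⟶x = y , x , y⟶x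
    Pr≡⅓ : ∀ {u v} → u ⟶ v → ∀ j → Pr[_,_↦_] H q (anchorEdge O (u , v)) j ≡ ⅓
    Pr≡⅓ {u} {v} u⟶v j = trans (Pr-pattern q j u v) (trans
      (∑-push (classes H) represented
        (λ S → minorityPattern j (lookup (side S) u) (lookup (side S) v))
        (λ I → minorityPattern j (lookup I u) (lookup I v)) (λ { _ _ refl → refl }))
      (trans (joint-marginal C (sound u⟶v) (minorityPattern j)) (single j)))
      where
      -- Each minority position corresponds to exactly one of the three equally likely membership
      -- patterns.
      single : ∀ j → (⅓ when minorityPattern j true false) + (⅓ when minorityPattern j false true)
                   + (⅓ when minorityPattern j false false) ≡ ⅓
      single zero             = refl
      single (suc zero)       = refl
      single (suc (suc zero)) = refl
    attained : ∃[ u ] ∃[ v ] u ⟶ v → ∃[ e ] ∃[ j ] e ∈ Hypergraph₃.hyperedges H × ⅓ ≡ Pr[_,_↦_] H q e j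
    attained (u , v , u⟶v) = _ , zero , arc⇒hyperedge u⟶v , sym (Pr≡⅓ u⟶v zero)
    bounded : ∀ {e} j → ∃[ u ] ∃[ v ] u ⟶ v × e ≡ anchorEdge O (u , v) → Pr[_,_↦_] H q e j ≤ ⅓
    bounded j (u , v , u⟶v , refl) = ≤-reflexive (Pr≡⅓ u⟶v j)

-- Noncontextual fraction

module _ (M : EmpiricalModel) where
  open EmpiricalModel M

  -- Assignments are functions, so they are compared pointwise on finitely many observables, which
  -- is decidable.
  Agree : List Obs → (t g : Obs → Bool) → Set
  Agree os t g = All (λ o → g o ≡ t o) os

  agree? : ∀ os t g → Dec (Agree os t g)
  agree? os t g = all? (λ o → g o Bool.≟ t o) os

  -- Exactly one listed assignment agrees with `t`: at each further observable, one of the two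
  -- extensions takes the value of `t`, and distinctness of the observables preserves the earlier
  -- values.
  ∑-assignmentsTo : ∀ c t {os} → Unique os →
    ∑ (assignmentsTo M os) (λ g → c when does (agree? os t g)) ≡ c
  ∑-assignmentsTo c t []                  = +-identityʳ c
  ∑-assignmentsTo c t {o ∷ os} (o∉ ∷ os!) =
    trans (∑-concatMap extensions (assignmentsTo M os))
      (trans (∑-cong (assignmentsTo M os) λ {g} _ → extend g) (∑-assignmentsTo c t os!))
    where
    update = _[_≔_] M
    extensions : (Obs → Bool) → List (Obs → Bool)
    extensions g = update g o false ∷ update g o true ∷ []
    at-o : ∀ g b → update g o b o ≡ b
    at-o g b = cong (λ d → if d then b else g o) (dec-true (o ≟ᵒ o) refl)
      where open EmpiricalModel M renaming (_≟_ to _≟ᵒ_)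
    off-o : ∀ g b {o′} → o′ ∈ os → update g o b o′ ≡ g o′
    off-o g b {o′} o′∈ = cong (λ d → if d then b else g o′) (dec-false (o ≟ᵒ o′) (All.lookup o∉ o′∈))
      where open EmpiricalModel M renaming (_≟_ to _≟ᵒ_)
    agrees : ∀ g b → does (agree? (o ∷ os) t (update g o b)) ≡ does (b Bool.≟ t o) ∧ does (agree? os t g)
    agrees g b = cong₂ _∧_ (cong (λ x → does (x Bool.≟ t o)) (at-o g b))
      (does-⇔ (mk⇔
          (λ h → All.tabulate λ o′∈ → trans (sym (off-o g b o′∈)) (All.lookup h o′∈))
          (λ h → All.tabulate λ o′∈ → trans (off-o g b o′∈) (All.lookup h o′∈)))
        (agree? os t (update g o b)) (agree? os t g))
    extend : ∀ g → ∑ (extensions g) (λ g → c when does (agree? (o ∷ os) t g)) ≡ (c when does (agree? os t g))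
    extend g rewrite agrees g false | agrees g true with t o
    ... | false = +-identityʳ _
    ... | true  = trans (+-identityˡ _) (+-identityʳ _)

  ∑-globalAssignments : ∀ c t → ∑ (globalAssignments M) (λ g → c when does (agree? observables t g)) ≡ c
  ∑-globalAssignments c t = ∑-assignmentsTo c t unique

  restrict-agree : ∀ {C} → C ∈ contexts → ∀ {t g} → Agree observables t g →
                   Vec.map g (Context.scope C) ≡ Vec.map t (Context.scope C)
  restrict-agree C∈ {t} {g} agree = go (All.lookup inScope C∈)
    where
    go : ∀ {k} {os : Vec Obs k} → VecAll.All (_∈ observables) os → Vec.map g os ≡ Vec.map t os
    go VecAll.[]         = refl
    go (o∈ VecAll.∷ os∈) = cong₂ _∷_ (All.lookup agree o∈) (go os∈)

  module _ {b : (Obs → Bool) → ℚ} (sub : IsSubmodel M b) {C : Context Obs} (C∈ : C ∈ contexts) where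
    open Context C

    -- Grouping assignments by their local outcome bounds the weight of any event of a context by
    -- the sum of its table entries.
    submodel-marginal : ∀ (Q : Vec Bool arity → Bool) →
      ∑ (globalAssignments M) (λ g → b g when Q (Vec.map g scope)) ≤
      ∑ (boolVecs arity) (λ u → table u when Q u)
    submodel-marginal Q = ≤-trans
      (≤-reflexive (sym (∑-push (boolVecs arity)
        (λ {g} _ → ∑-≡ (b g) (Vec.map g scope) (boolVecs-unique arity) (∈-boolVecs _))
        Q (λ g → Q (Vec.map g scope)) (λ { _ _ refl → refl }))))
      (∑-mono (boolVecs arity) λ {u} _ → bound u (Q u))
      where
      open Push (λ g u → restrictsTo? M C u g) (globalAssignments M) b
      bound : ∀ u q → (push u when q) ≤ (table u when q)
      bound u true  = All.lookup (proj₂ sub) C∈ u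
      bound u false = ≤-refl

    -- The weight of `g` is at most the table entry of its restriction, so a zero entry would force
    -- it to vanish.
    submodel-support : ∀ {g} → g ∈ globalAssignments M → b g ≢ 0ℚ → table (Vec.map g scope) ≢ 0ℚ
    submodel-support {g} g∈ bg≢0 table≡0 = bg≢0 (≤-antisym
      (≤-trans (term≤∑ _ (proj₁ sub) (∈-filter⁺ (restrictsTo? M C (Vec.map g scope)) g∈ refl))
        (≤-trans (All.lookup (proj₂ sub) C∈ (Vec.map g scope)) (≤-reflexive table≡0)))
      (proj₁ sub g))

module _ {n : ℕ} {G : SimpleGraph n} (O : Orientation G) where
  open SimpleGraph G using (Adj)
  open Orientation O

  private
    H : Hypergraph₃ (suc n)
    H = anchor O

    M : EmpiricalModel
    M = naeModel H

    Is = independentSets G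
    gs = globalAssignments M

  open EmpiricalModel M using (contexts; observables)

  naeContext∈ : ∀ {e} → e ∈ Hypergraph₃.hyperedges H → naeContext H e ∈ contexts
  naeContext∈ e∈ = ∈-++⁺ˡ (∈-map⁺ (naeContext H) e∈)

  copyContext∈ : ∀ {e} → e ∈ Hypergraph₃.hyperedges H → ∀ j → copyContext H (e , j) ∈ contexts
  copyContext∈ e∈ j = ∈-++⁺ʳ (map (naeContext H) (Hypergraph₃.hyperedges H))
    (∈-map⁺ (copyContext H) (∈-cartesianProduct⁺ e∈ (∈-allFin j)))

  central-colouring : (Observable (suc n) → Bool) → Colouring (suc n)
  central-colouring g = g (central zero) ∷ Vec.tabulate (λ v → g (central (suc v)))

  lookup-central-side : ∀ g v → lookup (side (central-colouring g)) v ≡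
                        does (g (central (suc v)) Bool.≟ g (central zero))
  lookup-central-side g v = trans (lookup-side (g (central zero)) (Vec.tabulate (λ v → g (central (suc v)))) v)
    (cong (λ b → does (b Bool.≟ g (central zero))) (Vec.lookup∘tabulate (λ v → g (central (suc v))) v))

  correlated⇒≡ : ∀ x y → perfectlyCorrelated (x ∷ y ∷ []) ≢ 0ℚ → x ≡ y
  correlated⇒≡ false false _ = refl
  correlated⇒≡ false true  h = contradiction refl h
  correlated⇒≡ true  false h = contradiction refl h
  correlated⇒≡ true  true  _ = refl

  nae-constant : ∀ x → uniformNAE₃ (x ∷ x ∷ x ∷ []) ≡ 0ℚ
  nae-constant false = refl
  nae-constant true  = refl

  module _ {b : (Observable (suc n) → Bool) → ℚ} (sub : IsSubmodel M b) where

    copies-agree : ∀ {e} → e ∈ Hypergraph₃.hyperedges H → ∀ j {g} → g ∈ gs → b g ≢ 0ℚ →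
                   g (central (lookup e j)) ≡ g (fresh e j)
    copies-agree {e} e∈ j {g} g∈ bg≢0 = correlated⇒≡ (g (central (lookup e j))) (g (fresh e j))
      (submodel-support M {b} sub {copyContext H (e , j)} (copyContext∈ e∈ j) g∈ bg≢0)

    -- If both ends of an arc shared the anchor's colour, the fresh copies, which agree with the
    -- central observables, would form a constant triple, where the NAE table is zero.
    support-independent : ∀ {g} → g ∈ gs → b g ≢ 0ℚ → Independent G (side (central-colouring g))
    support-independent {g} g∈ bg≢0 = arcs⇒independent O λ {u} {v} u⟶v u∈ v∈ →
      let e   = anchorEdge O (u , v)
          e∈  = arc⇒hyperedge O u⟶v
          r   = g (central zero)
          copy : ∀ j → g (central (lookup e j)) ≡ r → r ≡ g (fresh e j)
          copy j eq = trans (sym eq) (copies-agree e∈ j g∈ bg≢0)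
          c₀ = copy zero refl
          c₁ = copy (suc zero) (same⇒≡ (trans (sym (lookup-central-side g u)) u∈))
          c₂ = copy (suc (suc zero)) (same⇒≡ (trans (sym (lookup-central-side g v)) v∈))
      in  submodel-support M {b} sub {naeContext H e} (naeContext∈ e∈) g∈ bg≢0
            (trans (cong₂ (λ x y → uniformNAE₃ (x ∷ proj₁ y ∷ proj₂ y ∷ [])) (sym c₀) (cong₂ _,_ (sym c₁) (sym c₂)))
              (nae-constant r))

    -- On the support the event that `v` and the anchor differ can be read off the fresh copies, and
    -- its weight is then bounded inside the NAE context.
    missed-by-pattern : ∀ {e} → e ∈ Hypergraph₃.hyperedges H → ∀ {v} j → lookup e zero ≡ zero → lookup e j ≡ suc v →
      ∑ gs (λ g → b g when not (lookup (side (central-colouring g)) v)) ≤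
      ∑ (boolVecs 3) (λ u → uniformNAE₃ u when not (does (lookup u j Bool.≟ lookup u zero)))
    missed-by-pattern {e} e∈ {v} j e₀ eⱼ = ≤-trans (≤-reflexive (∑-cong gs λ {g} g∈ → pointwise g g∈))
      (submodel-marginal M {b} sub {naeContext H e} (naeContext∈ e∈)
        (λ u → not (does (lookup u j Bool.≟ lookup u zero))))
      where
      scope = Context.scope (naeContext H e)
      restricted : ∀ g → g ∈ gs → b g ≢ 0ℚ → ∀ j → g (central (lookup e j)) ≡ lookup (Vec.map g scope) j
      restricted g g∈ bg≢0 j = trans (copies-agree e∈ j g∈ bg≢0) (sym (trans (Vec.lookup-map j g scope)
        (cong g (trans (Vec.lookup-map j (λ j → fresh e j) (Vec.allFin 3))
          (cong (λ j → fresh e j) (Vec.lookup-allFin j))))))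
      pointwise : ∀ g → g ∈ gs → (b g when not (lookup (side (central-colouring g)) v)) ≡
                  (b g when not (does (lookup (Vec.map g scope) j Bool.≟ lookup (Vec.map g scope) zero)))
      pointwise g g∈ with b g ≟ 0ℚ
      ... | yes bg≡0 rewrite bg≡0 = trans (0-when (not (lookup (side (central-colouring g)) v)))
        (sym (0-when (not (does (lookup (Vec.map g scope) j Bool.≟ lookup (Vec.map g scope) zero)))))
      ... | no bg≢0 = cong (λ x → b g when not x) (trans (lookup-central-side g v)
        (cong₂ (λ x y → does (x Bool.≟ y))
          (trans (cong (λ v → g (central v)) (sym eⱼ)) (restricted g g∈ bg≢0 j))
          (trans (cong (λ v → g (central v)) (sym e₀)) (restricted g g∈ bg≢0 zero))))

  NCF⇒small-colouring : NoIsolatedVertices G → IsNCF M 1ℚ → SmallColouring G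
  NCF⇒small-colouring noIso ((b , sub , 1≡total) , _) =
    small-colouring G gs b (λ g → side (central-colouring g)) (proj₁ sub)
      (support-independent sub) (sym 1≡total) missed
    where
    missed : ∀ v → ∑ gs (λ g → b g when not (lookup (side (central-colouring g)) v)) ≤ ⅔
    missed v with noIso v
    ... | x , vx with covers vx
    -- The bound evaluates to `⅔`: two given positions differ in four of the six NAE triples.
    ... | inj₁ v⟶x = missed-by-pattern sub (arc⇒hyperedge O v⟶x) (suc zero) refl refl
    ... | inj₂ x⟶v = missed-by-pattern sub (arc⇒hyperedge O x⟶v) (suc (suc zero)) refl refl

  -- The total weight is the always-true event of one NAE context, whose table sums to 1 by
  -- evaluation.
  NCF≤1 : ∀ {u v} → u ⟶ v → ∀ y → ∃[ b ] IsSubmodel M b × y ≡ ∑ gs b → y ≤ 1ℚ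
  NCF≤1 u⟶v y (b , sub , refl) =
    submodel-marginal M {b} sub {naeContext H _} (naeContext∈ (arc⇒hyperedge O u⟶v)) (λ _ → true)

  assignment : Bool → Subset n → Observable (suc n) → Bool
  assignment s I (central v) = lookup (colouringOf s I) v
  assignment s I (fresh e j) = lookup (colouringOf s I) (lookup e j)

  module _ (C : UniformColouring G) where
    open UniformColouring C

    private
      module P (s : Bool) = Push (λ I g → agree? M observables (assignment s I) g) Is weight

    -- The anchor gets either colour with probability ½.
    mixture : (Observable (suc n) → Bool) → ℚ
    mixture g = ½ * (P.push false g + P.push true g)

    mixture-nonneg : ∀ g → 0ℚ ≤ mixture g
    mixture-nonneg g = *-nonneg (nonNegative⁻¹ ½)
      (+-mono-≤ (P.push-nonneg false (λ {I} _ → weight-nonneg I) g)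
                (P.push-nonneg true (λ {I} _ → weight-nonneg I) g))

    -- Each pair of an anchor colour and an independent set sends its weight to the one listed
    -- assignment that agrees with it, so an event `p` can be evaluated as `q` on such pairs.
    ∑-mixture : (p : (Observable (suc n) → Bool) → Bool) (q : Bool → Subset n → Bool) →
      (∀ s {I g} → Agree M observables (assignment s I) g → p g ≡ q s I) →
      ∑ gs (λ g → mixture g when p g) ≡
      ½ * (∑ Is (λ I → weight I when q false I) + ∑ Is (λ I → weight I when q true I))
    ∑-mixture p q compat = begin
      ∑ gs (λ g → mixture g when p g)
        ≡⟨ ∑-cong gs (λ {g} _ → distribute g (p g)) ⟩
      ∑ gs (λ g → ½ * ((P.push false g when p g) + (P.push true g when p g)))
        ≡⟨ ∑-* ½ gs ⟩
      ½ * ∑ gs (λ g → (P.push false g when p g) + (P.push true g when p g))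
        ≡⟨ cong (½ *_) (∑-+ gs) ⟩
      ½ * (∑ gs (λ g → P.push false g when p g) + ∑ gs (λ g → P.push true g when p g))
        ≡⟨ cong (½ *_) (cong₂ _+_ (pushed false) (pushed true)) ⟩
      ½ * (∑ Is (λ I → weight I when q false I) + ∑ Is (λ I → weight I when q true I)) ∎
      where
      open ≡-Reasoning
      distribute : ∀ g b → (mixture g when b) ≡ ½ * ((P.push false g when b) + (P.push true g when b))
      distribute g true  = refl
      distribute g false = refl
      pushed : ∀ s → ∑ gs (λ g → P.push s g when p g) ≡ ∑ Is (λ I → weight I when q s I)
      pushed s = P.∑-push s gs (λ {I} _ → ∑-globalAssignments M (weight I) (assignment s I))
        p (q s) (λ _ _ → compat s)

    mixture-total : ∑ gs mixture ≡ 1ℚ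
    mixture-total = trans (∑-mixture (λ _ → true) (λ _ _ → true) (λ _ _ → refl))
      (cong (½ *_) (cong₂ _+_ total total))

    restricted : ∀ s I (D : Context (Observable (suc n))) → Vec Bool (Context.arity D) → Bool
    restricted s I D w = does (Vec.≡-dec Bool._≟_ (Vec.map (assignment s I) (Context.scope D)) w)

    mixture-marginal : ∀ {D} → D ∈ contexts → ∀ w → ∑ (filter (restrictsTo? M D w) gs) mixture ≡
      ½ * (∑ Is (λ I → weight I when restricted false I D w) + ∑ Is (λ I → weight I when restricted true I D w))
    mixture-marginal {D} D∈ w = trans (∑-filter (restrictsTo? M D w) gs)
      (∑-mixture (λ g → does (restrictsTo? M D w g)) (λ s I → restricted s I D w)
        (λ s agree → cong (λ x → does (Vec.≡-dec Bool._≟_ x w)) (restrict-agree M D∈ agree)))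

    -- Given the anchor colour `s`, the three membership patterns produce the three NAE triples
    -- starting with `s`, each with probability one third; the fair coin halves this to one sixth.
    nae-marginal : ∀ {u v} → u ⟶ v → ∀ w →
      ½ * (∑ Is (λ I → weight I when restricted false I (naeContext H (anchorEdge O (u , v))) w)
         + ∑ Is (λ I → weight I when restricted true  I (naeContext H (anchorEdge O (u , v))) w)) ≡ uniformNAE₃ w
    nae-marginal {u} {v} u⟶v w = trans (cong (½ *_) (cong₂ _+_ (half false) (half true))) (table w)
      where
      matches : Bool → Vec Bool 3 → Bool → Bool → Bool
      matches s w p q = does (Vec.≡-dec Bool._≟_ (s ∷ does (p Bool.≟ s) ∷ does (q Bool.≟ s) ∷ []) w)
      pr : Bool → Vec Bool 3 → ℚ
      pr s w = (⅓ when matches s w true false) + (⅓ when matches s w false true) + (⅓ when matches s w false false)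
      half : ∀ s → ∑ Is (λ I → weight I when restricted s I (naeContext H (anchorEdge O (u , v))) w) ≡ pr s w
      half s = trans
        (∑-cong Is λ {I} _ → cong₂ (λ x y → weight I when does (Vec.≡-dec Bool._≟_ (s ∷ x ∷ y ∷ []) w))
          (Vec.lookup-map u _ I) (Vec.lookup-map v _ I))
        (joint-marginal C (sound u⟶v) (matches s w))
      table : ∀ w → ½ * (pr false w + pr true w) ≡ uniformNAE₃ w
      table (false ∷ false ∷ false ∷ []) = refl
      table (false ∷ false ∷ true  ∷ []) = refl
      table (false ∷ true  ∷ false ∷ []) = refl
      table (false ∷ true  ∷ true  ∷ []) = refl
      table (true  ∷ false ∷ false ∷ []) = refl
      table (true  ∷ false ∷ true  ∷ []) = refl
      table (true  ∷ true  ∷ false ∷ []) = refl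
      table (true  ∷ true  ∷ true  ∷ []) = refl

    -- A copy always equals its central observable, and for each `I` the two anchor colours give
    -- opposite values. Each diagonal outcome thus receives the full weight once, before halving.
    copy-marginal : ∀ e j w →
      ½ * (∑ Is (λ I → weight I when restricted false I (copyContext H (e , j)) w)
         + ∑ Is (λ I → weight I when restricted true  I (copyContext H (e , j)) w)) ≡ perfectlyCorrelated w
    copy-marginal e j w@(x ∷ y ∷ []) = trans (cong (½ *_) (trans (sym (∑-+ Is)) (trans
      (∑-cong Is λ {I} _ → pointwise I)
      (trans (∑-when (does (x Bool.≟ y)) Is) (cong (_when does (x Bool.≟ y)) total))))) (table x y)
      where
      diagonal : Bool → Bool
      diagonal c = does (Vec.≡-dec Bool._≟_ (c ∷ c ∷ []) w)
      exclusive : ∀ z c x y →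
        (z when does (Vec.≡-dec Bool._≟_ (c ∷ c ∷ []) (x ∷ y ∷ []))) +
        (z when does (Vec.≡-dec Bool._≟_ (not c ∷ not c ∷ []) (x ∷ y ∷ []))) ≡ (z when does (x Bool.≟ y))
      exclusive z false false false = +-identityʳ z
      exclusive z false false true  = refl
      exclusive z false true  false = refl
      exclusive z false true  true  = +-identityˡ z
      exclusive z true  false false = +-identityˡ z
      exclusive z true  false true  = refl
      exclusive z true  true  false = refl
      exclusive z true  true  true  = +-identityʳ z
      pointwise : ∀ I → (weight I when restricted false I (copyContext H (e , j)) w)
                      + (weight I when restricted true  I (copyContext H (e , j)) w) ≡
                  (weight I when does (x Bool.≟ y))
      pointwise I = trans
        (cong (λ c → (weight I when diagonal (lookup (colouringOf false I) (lookup e j))) + (weight I when diagonal c))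
          opposite)
        (exclusive (weight I) (lookup (colouringOf false I) (lookup e j)) x y)
        where
        opposite : lookup (colouringOf true I) (lookup e j) ≡ not (lookup (colouringOf false I) (lookup e j))
        opposite = trans (cong (λ S → lookup S (lookup e j)) (colouringOf-not false I))
          (Vec.lookup-map (lookup e j) not (colouringOf false I))
      table : ∀ x y → ½ * (1ℚ when does (x Bool.≟ y)) ≡ perfectlyCorrelated (x ∷ y ∷ [])
      table false false = refl
      table false true  = refl
      table true  false = refl
      table true  true  = refl

    mixture-submodel : IsSubmodel M mixture
    mixture-submodel = mixture-nonneg , All.++⁺
      (All.map⁺ (All.tabulate λ e∈ w → nae (hyperedge⇒arc O e∈) e∈ w))
      (All.map⁺ (All.tabulate λ { {e , j} ej∈ w →
        let e∈ = proj₁ (∈-cartesianProduct⁻ (Hypergraph₃.hyperedges H) (allFin 3) ej∈)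
        in  ≤-reflexive (trans (mixture-marginal {copyContext H (e , j)} (copyContext∈ e∈ j) w)
                             (copy-marginal e j w)) }))
      where
      nae : ∀ {e} → ∃[ u ] ∃[ v ] u ⟶ v × e ≡ anchorEdge O (u , v) → e ∈ Hypergraph₃.hyperedges H →
            ∀ w → ∑ (filter (restrictsTo? M (naeContext H e) w) gs) mixture ≤ uniformNAE₃ w
      nae {e} (u , v , u⟶v , refl) e∈ w =
        ≤-reflexive (trans (mixture-marginal {naeContext H e} (naeContext∈ e∈) w) (nae-marginal u⟶v w))

  uniform-colouring⇒NCF : HasEdge G → UniformColouring G → IsNCF M 1ℚ
  uniform-colouring⇒NCF (x , y , xy) C =
    (mixture C , mixture-submodel C , sym (mixture-total C)) , bounded (covers xy)
    where
    bounded : x ⟶ y ⊎ y ⟶ x → ∀ z → ∃[ b ] IsSubmodel M b × z ≡ ∑ gs b → z ≤ 1ℚ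
    bounded (inj₁ x⟶y) = NCF≤1 x⟶y
    bounded (inj₂ y⟶x) = NCF≤1 y⟶x

-- A witness of weight at most 3 is a feasible point, so the minimum exists and lies below it;
-- conversely, the minimum is attained by a colouring.
chromatic-number≤3⇔small-colouring : ∀ {n} (G : SimpleGraph n) →
  SmallColouring G ⇔ (∃[ χ ] IsFractionalChromaticNumber G χ × χ ≤ + 3 / 1)
chromatic-number≤3⇔small-colouring G = mk⇔
  (λ (w , col , ≤3) → let χ , isχ , χ≤ = chromatic-number-exists G col in χ , isχ , ≤-trans χ≤ ≤3)
  (λ { (_ , ((w , col , refl) , _) , χ≤3) → w , col , χ≤3 })

theorem5p3 : ∀ {n : ℕ} (G : SimpleGraph n) (O : Orientation G) →
    HasEdge G → NoIsolatedVertices G →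
    (IsBeta (anchor O) (+ 1 / 3)
    ⇔ (∃[ χ ] IsFractionalChromaticNumber G χ × χ ≤ + 3 / 1))
    ×
    (IsNCF (naeModel (anchor O)) 1ℚ
    ⇔ (∃[ χ ] IsFractionalChromaticNumber G χ × χ ≤ + 3 / 1))
theorem5p3 G O edge noIso =
  mk⇔ (to small ∘ beta⇒small-colouring O noIso) (uniform-colouring⇒beta O edge ∘ uniform ∘ from small) ,
  mk⇔ (to small ∘ NCF⇒small-colouring O noIso) (uniform-colouring⇒NCF O edge ∘ uniform ∘ from small)
  where
  small = chromatic-number≤3⇔small-colouring G
  uniform : SmallColouring G → UniformColouring G
  uniform (_ , col , ≤3) = uniform-colouring G col ≤3
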